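{- Let $\mathcal{M}=(S,A,X,\delta,T,\rho)$ be a wpMDP whose target states are $T=\{t_0,\dots,t_n\}$ with $n\ge 1$ and $0=\rho(t_0)<\rho(t_1)<\dots<\rho(t_n)$, and let $\mathcal{G}(\mathcal{M})=(V,E)$. Let $\mathcal{N}$ be the pMDP obtained from $\mathcal{M}$ as follows: add two fresh states $\mathit{fin}$ and $\mathit{fail}$ (which become the only target states of $\mathcal{N}$, with weights $1$ and $0$), add a fresh action $a\notin A$, keep all transitions of $\mathcal{M}$, and for every $t\in T$ (which is no longer a target in $\mathcal{N}$) set $\delta'(t,a,\mathit{fin})=\rho(t)/\rho(t_n)$ and $\delta'(t,a,\mathit{fail})=1-\rho(t)/\rho(t_n)$ (all other new transitions being $0$). Then for every $v\in V$ and every $W\subseteq V$: $v\trianglelefteq W$ holds in $\mathcal{M}$ if and only if $v\trianglelefteq W$ holds in $\mathcal{N}$.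
   Context: A weighted parametric MDP (wpMDP) is a tuple $\mathcal{M}=(S,A,X,\delta,T,\rho)$ with finite sets $S$ of states, $A$ of actions, $X$ of parameters, a set $T\subseteq S$ of target states, a transition function $\delta:(S\setminus T)\times A\times S\to\mathbb{Q}[X]$ (polynomials with rational coefficients) and a weight function $\rho:T\to\mathbb{Q}$. Target states have no outgoing transitions. Its graph $\mathcal{G}(\mathcal{M})=(V,E)$ has vertex set $V=S\cup S_N$ where $S_N=(S\setminus T)\times A$ (state-action pairs), an edge $(s,(s,a))$ whenever $\delta(s,a,s')\not\equiv 0$ (not syntactically zero) for some $s'\in S$ other than the designated zero-weight target $\mathit{fail}$, and an edge $((s,a),s')$ whenever $\delta(s,a,s')\not\equiv 0$; $vE$ denotes the set of successors of $v$. A valuation $\mathsf{val}:X\to\mathbb{R}$ is graph-preserving if for all $s\in S\setminus T$, $a\in A$, $s'\in S$: $\delta(s,a,s')[\mathsf{val}]\ge 0$, $\sum_{s''\in S}\delta(s,a,s'')[\mathsf{val}]=1$, and $\delta(s,a,s')\not\equiv0$ implies $\delta(s,a,s')[\mathsf{val}]\neq 0$. A strategy is a map $\sigma:S\setminus T\to A$; together with $\mathsf{val}$ it induces a Markov chain moving from $s$ to $s'$ with probability $\delta(s,\sigma(s),s')[\mathsf{val}]$. For a state $s$, $\mathrm{Rew}^\sigma_{\mathsf{val}}(s)=\sum_{t\in T}\rho(t)\,\mathbb{P}^s[\Diamond t]$, where $\mathbb{P}^s[\Diamond t]$ is the probability of reaching $t$ from $s$ in that chain; for $(s,a)\in S_N$,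 $\mathrm{Rew}^\sigma_{\mathsf{val}}((s,a))=\sum_{s'\in (s,a)E}\delta(s,a,s')[\mathsf{val}]\cdot\mathrm{Rew}^\sigma_{\mathsf{val}}(s')$. Let $\mathrm{Rew}^*_{\mathsf{val}}(v)=\max_\sigma \mathrm{Rew}^\sigma_{\mathsf{val}}(v)$. A pMDP is a wpMDP with $T=\{\mathit{fin},\mathit{fail}\}$, $\rho(\mathit{fin})=1$, $\rho(\mathit{fail})=0$. Never-worse relation: for $v\in V$ and $W\subseteq V$, $v\trianglelefteq W$ iff for every graph-preserving valuation $\mathsf{val}$ there exists $w\in W$ with $\mathrm{Rew}^*_{\mathsf{val}}(v)\le \mathrm{Rew}^*_{\mathsf{val}}(w)$ (values computed in the respective model).
   Formalization: In the definition of graph-preserving, the transition probabilities must sum to 1 only for state-action pairs with some transition not identically zero; choosing any other pair stops the run. Read literally, N would have no graph-preserving valuation and the claim would fail. -}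

module Defs where

open import Level using (0ℓ) renaming (suc to lsuc)
open import Algebra.Bundles using (CommutativeRing)
import Algebra.Definitions.RawMonoid as RawMonoidDefs
open import Data.Bool.Base using (if_then_else_)
open import Data.Empty using (⊥)
open import Data.Fin.Base as Fin using (Fin; toℕ; fromℕ)
import Data.Fin.Properties as Fin
open import Data.Integer.Base using (ℤ; +_; -[1+_])
open import Data.List.Base using (List; []; _∷_; foldr)
open import Data.List.Relation.Unary.All using (All; all?)
open import Data.Maybe.Base using (Maybe; just; nothing)
open import Data.Nat.Base as ℕ using (ℕ; zero; suc)
open import Data.Product.Base using (Σ; ∃; ∃-syntax; _×_; _,_; proj₂)
open import Data.Rational.Base as ℚ using (ℚ; 0ℚ; 1ℚ; ↥_; ↧ₙ_)
import Data.Rational.Properties as ℚ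
open import Data.Sum.Base using (_⊎_; inj₁; inj₂)
open import Data.Sum.Function.Propositional using (_⊎-↔_)
open import Data.Sum.Properties using (≡-dec)
open import Data.Vec.Base using (Vec; []; _∷_)
open import Function.Base using (_∘_)
open import Function.Bundles using (_↔_; module Inverse; mk↔ₛ′)
open import Function.Properties.Inverse using (↔-sym; ↔-trans; ↔⇒↣)
open import Relation.Binary.Core using (Rel)
open import Relation.Binary.Definitions using (DecidableEquality)
open import Relation.Binary.PropositionalEquality
  using (_≡_; refl; sym; cong; subst)
open import Relation.Binary.Structures using (IsDecTotalOrder)
open import Relation.Nullary using (¬_; Dec; does; ¬?)
open import Relation.Nullary.Decidable using (map′)
open import Relation.Unary using (Pred)

-- The library has no real numbers.  They are specified (classically, up to
-- unique isomorphism) as a Dedekind-complete ordered field.  Inverse and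
-- supremum are total operations whose values are unspecified at 0 and at
-- empty or unbounded sets respectively.

record CompleteOrderedField : Set (lsuc 0ℓ) where
  field
    commutativeRing : CommutativeRing 0ℓ 0ℓ

  open CommutativeRing commutativeRing public

  infix  4 _≤_
  infix  8 _⁻¹

  field
    _≤_             : Rel Carrier 0ℓ
    isDecTotalOrder : IsDecTotalOrder _≈_ _≤_
    +-monoʳ-≤       : ∀ x {y z} → y ≤ z → x + y ≤ x + z
    *-nonneg        : ∀ {x y} → 0# ≤ x → 0# ≤ y → 0# ≤ x * y
    0≉1             : ¬ (0# ≈ 1#)
    _⁻¹             : Carrier → Carrier
    *-inverseʳ      : ∀ {x} → ¬ (x ≈ 0#) → x * x ⁻¹ ≈ 1#

  UpperBound : Pred Carrier 0ℓ → Carrier → Set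
  UpperBound P b = ∀ {x} → P x → x ≤ b

  field
    sup       : Pred Carrier 0ℓ → Carrier
    sup-upper : ∀ {P} → ∃ P → ∃ (UpperBound P) → UpperBound P (sup P)
    sup-least : ∀ {P} → ∃ P → ∀ {b} → UpperBound P b → sup P ≤ b

  open RawMonoidDefs +-rawMonoid public using (sum) renaming (_×_ to _×ℕ_)

  fromℤ : ℤ → Carrier
  fromℤ (+ n)    = n ×ℕ 1#
  fromℤ -[1+ n ] = - (suc n ×ℕ 1#)

  fromℚ : ℚ → Carrier
  fromℚ q = fromℤ (↥ q) * (↧ₙ q ×ℕ 1#) ⁻¹

Finite : Set → Set
Finite B = ∃[ n ] (Fin n ↔ B)

finite-≟ : ∀ {B} → Finite B → DecidableEquality B
finite-≟ (_ , e) = Fin.inj⇒≟ (↔⇒↣ (↔-sym e))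

finite-⊎ : ∀ {B C} → Finite B → Finite C → Finite (B ⊎ C)
finite-⊎ (m , e) (n , f) = m ℕ.+ n , ↔-trans Fin.+↔⊎ (e ⊎-↔ f)

finite-Maybe : ∀ {B} → Finite B → Finite (Maybe B)
finite-Maybe {B} (n , e) = suc n , mk↔ₛ′ to′ from′ to∘from from∘to
  where
  open Inverse e
  to′ : Fin (suc n) → Maybe B
  to′ Fin.zero    = nothing
  to′ (Fin.suc i) = just (to i)
  from′ : Maybe B → Fin (suc n)
  from′ nothing  = Fin.zero
  from′ (just b) = Fin.suc (from b)
  to∘from : ∀ b → to′ (from′ b) ≡ b
  to∘from nothing  = refl
  to∘from (just b) = cong just (strictlyInverseˡ b)
  from∘to : ∀ i → from′ (to′ i) ≡ i
  from∘to Fin.zero    = refl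
  from∘to (Fin.suc i) = cong Fin.suc (strictlyInverseʳ i)

-- ℚ[x₀,…,xₙ] as ℚ[x₁,…,xₙ][x₀]: the list of coefficients of x₀⁰, x₀¹, ….
-- Trailing zero coefficients are allowed, so the zero polynomial has several
-- representations, all of which satisfy IsZero.

Poly : ℕ → Set
Poly zero    = ℚ
Poly (suc n) = List (Poly n)

const : ∀ n → ℚ → Poly n
const zero    q = q
const (suc n) q = const n q ∷ []

IsZero : ∀ n → Poly n → Set
IsZero zero    q  = q ≡ 0ℚ
IsZero (suc n) ps = All (IsZero n) ps

isZero? : ∀ n (p : Poly n) → Dec (IsZero n p)
isZero? zero    q  = q ℚ.≟ 0ℚ
isZero? (suc n) ps = all? (isZero? n) ps

module _ (ℝ : CompleteOrderedField) where
  open CompleteOrderedField ℝ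

  eval : ∀ n → Poly n → (Fin n → Carrier) → Carrier
  eval zero    q  val = fromℚ q
  eval (suc n) ps val =
    foldr (λ p r → eval n p (val ∘ Fin.suc) + val Fin.zero * r) 0# ps

-- The set of states S is the disjoint union of Inner = S ∖ T and Target = T,
-- and the set of parameters X is Fin params.  The field someAction says that
-- A is nonempty unless S = T, i.e. that strategies exist: otherwise the
-- maximum over all strategies would be undefined.

record WPMDP : Set₁ where
  field
    Inner Target Action : Set
    finiteInner         : Finite Inner
    finiteTarget        : Finite Target
    finiteAction        : Finite Action
    params              : ℕ

  State : Set
  State = Inner ⊎ Target

  field
    δ          : Inner → Action → State → Poly params
    ρ          : Target → ℚ
    someAction : Inner → Action

  finiteState : Finite State
  finiteState = finite-⊎ finiteInner finiteTarget

  _≟_ : DecidableEquality State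
  _≟_ = ≡-dec (finite-≟ finiteInner) (finite-≟ finiteTarget)

  NonZeroδ : Inner → Action → State → Set
  NonZeroδ s a s′ = ¬ IsZero params (δ s a s′)

  Enabled : Inner → Action → Set
  Enabled s a = ∃[ s′ ] NonZeroδ s a s′

  IsFail : State → Set
  IsFail (inj₁ _) = ⊥
  IsFail (inj₂ t) = ρ t ≡ 0ℚ

  data Vertex : Set where
    state : State → Vertex
    pair  : Inner → Action → Vertex

  data Edge : Vertex → Vertex → Set where
    choose : ∀ {s a s′} → ¬ IsFail s′ → NonZeroδ s a s′ →
             Edge (state (inj₁ s)) (pair s a)
    move   : ∀ {s a s′} → NonZeroδ s a s′ → Edge (pair s a) (state s′)

  move? : ∀ s a s′ → Dec (Edge (pair s a) (state s′))
  move? s a s′ = map′ move (λ { (move nz) → nz }) (¬? (isZero? params (δ s a s′)))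

  Strategy : Set
  Strategy = Inner → Action

module Semantics (ℝ : CompleteOrderedField) (M : WPMDP) where
  open CompleteOrderedField ℝ
  open WPMDP M

  ∑ : ∀ {B} → Finite B → (B → Carrier) → Carrier
  ∑ (_ , e) f = sum (f ∘ Inverse.to e)

  Valuation : Set
  Valuation = Fin params → Carrier

  prob : Valuation → Inner → Action → State → Carrier
  prob val s a s′ = eval ℝ params (δ s a s′) val

  -- Probabilities sum to 1 for the pairs that have transitions at all.  A
  -- pair with all transitions 0 is regarded as a disabled action; choosing it
  -- stops the run.  (toPMDP below produces such pairs.)
  record GraphPreserving (val : Valuation) : Set where
    field
      nonnegative : ∀ s a s′ → 0# ≤ prob val s a s′
      total       : ∀ s a → Enabled s a → ∑ finiteState (prob val s a) ≈ 1#
      nonzero     : ∀ s a s′ → NonZeroδ s a s′ → ¬ (prob val s a s′ ≈ 0#)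

  module Chain (val : Valuation) (σ : Strategy) where

    step : State → State → Carrier
    step (inj₁ s) s′ = prob val s (σ s) s′
    step (inj₂ _) _  = 0#

    -- probability of the cylinder set of the finite path s, π₁, …, πₖ
    cylinder : ∀ {k} → State → Vec State k → Carrier
    cylinder s []       = 1#
    cylinder s (s′ ∷ π) = step s s′ * cylinder s′ π

    end : ∀ {k} → State → Vec State k → State
    end s []       = s
    end _ (s′ ∷ π) = end s′ π

    ∑paths : ∀ k → (Vec State k → Carrier) → Carrier
    ∑paths zero    f = f []
    ∑paths (suc k) f = ∑ finiteState (λ s → ∑paths k (f ∘ (s ∷_)))

    -- probability of reaching t after exactly k steps
    ℙ◇⁼ : ℕ → State → Target → Carrier
    ℙ◇⁼ k s t =
      ∑paths k (λ π → if does (end s π ≟ inj₂ t) then cylinder s π else 0#)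

    -- A target has no outgoing transitions, so the event of reaching t is the
    -- disjoint union over k of the events of reaching it after k steps, and
    -- its probability is the sum of the series of nonnegative terms ℙ◇⁼ k s t.
    ℙ◇ : State → Target → Carrier
    ℙ◇ s t = sup (λ x → ∃[ n ] x ≈ sum {n} (λ k → ℙ◇⁼ (toℕ k) s t))

    Rew : Vertex → Carrier
    Rew (state s)  = ∑ finiteTarget (λ t → fromℚ (ρ t) * ℙ◇ s t)
    Rew (pair s a) = ∑ finiteState λ s′ →
      if does (move? s a s′) then prob val s a s′ * Rew (state s′) else 0#

  open Chain public using (Rew)

  -- Rew* val v x means that x is the maximum of Rew val σ v over all σ.
  Rew* : Valuation → Vertex → Carrier → Set
  Rew* val v x = (∃[ σ ] Rew val σ v ≈ x) × (∀ σ → Rew val σ v ≤ x)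

  infix 4 _⊴_
  _⊴_ : Vertex → Pred Vertex 0ℓ → Set
  v ⊴ W = ∀ val → GraphPreserving val →
    ∃[ w ] W w × (∃[ x ] ∃[ y ] Rew* val v x × Rew* val w y × x ≤ y)

record TargetOrder (M : WPMDP) : Set where
  open WPMDP M
  field
    n          : ℕ
    1≤n        : 1 ℕ.≤ n
    targets    : Fin (suc n) ↔ Target

  t : Fin (suc n) → Target
  t = Inverse.to targets

  field
    lowest     : ρ (t Fin.zero) ≡ 0ℚ
    increasing : ∀ {i j} → i Fin.< j → ρ (t i) ℚ.< ρ (t j)

  tₙ : Target
  tₙ = t (fromℕ n)

  instance
    ρtₙ-nonZero : ℚ.NonZero (ρ tₙ)
    ρtₙ-nonZero = ℚ.>-nonZero (subst (ℚ._< ρ tₙ) lowest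
      (increasing (subst (0 ℕ.<_) (sym (Fin.toℕ-fromℕ n)) 1≤n)))

data Outcome : Set where
  fin fail : Outcome

finiteOutcome : Finite Outcome
finiteOutcome = 2 , mk↔ₛ′
  (λ { Fin.zero → fin ; (Fin.suc Fin.zero) → fail })
  (λ { fin → Fin.zero ; fail → Fin.suc Fin.zero })
  (λ { fin → refl ; fail → refl })
  (λ { Fin.zero → refl ; (Fin.suc Fin.zero) → refl })

-- The fresh action is nothing; an action a of M becomes just a.
module _ (M : WPMDP) (o : TargetOrder M) where
  open WPMDP M
  open TargetOrder o

  toPMDP : WPMDP
  toPMDP = record
    { Inner        = State
    ; Target       = Outcome
    ; Action       = Maybe Action
    ; finiteInner  = finiteState
    ; finiteTarget = finiteOutcome
    ; finiteAction = finite-Maybe finiteAction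
    ; params       = params
    ; δ            = δ′
    ; ρ            = λ { fin → 1ℚ ; fail → 0ℚ }
    ; someAction   = λ _ → nothing
    }
    where
    δ′ : State → Maybe Action → State ⊎ Outcome → Poly params
    δ′ (inj₁ s) (just a) (inj₁ s′)   = δ s a s′
    δ′ (inj₂ t) nothing  (inj₂ fin)  = const params (ρ t ℚ.÷ ρ tₙ)
    δ′ (inj₂ t) nothing  (inj₂ fail) = const params (1ℚ ℚ.- ρ t ℚ.÷ ρ tₙ)
    δ′ _        _        _           = const params 0ℚ

  embed : Vertex → WPMDP.Vertex toPMDP
  embed (state s)  = WPMDP.state (inj₁ s)
  embed (pair s a) = WPMDP.pair (inj₁ s) (just a)

  image : Pred Vertex 0ℓ → Pred (WPMDP.Vertex toPMDP) 0ℓ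
  image W u = ∃[ w ] W w × u ≡ embed w

{-# OPTIONS --safe #-}

-- For a fixed valuation, a strategy σ of M yields a strategy of N that follows
-- σ and takes the fresh action in the targets.  A run of N then reaches fin
-- exactly one step after it has reached some t ∈ T and won a lottery with
-- success probability ρ(t)/ρ(tₙ), so the rewards in N are those in M divided
-- by ρ(tₙ) > 0.  Strategies of N may also take disabled actions, but repairing
-- these choices decreases no transition probability and hence no reward.
-- So the maxima exist in both models simultaneously, and their order is the
-- same.

module Submission where

open import Level using (0ℓ)
import Algebra.Properties.CommutativeSemigroup as CommutativeSemigroupProperties
import Algebra.Properties.Ring as RingProperties
import Algebra.Properties.Semiring.Mult as Mult
import Algebra.Properties.Semiring.Sum as SemiringSum
open import Data.Bool.Base using (Bool; true; false; if_then_else_)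
open import Data.Fin.Base as Fin using (Fin; toℕ; fromℕ; _↑ˡ_; _↑ʳ_)
import Data.Fin.Properties as Fin
open import Data.Integer.Base as ℤ using (ℤ; +_; -[1+_]; _⊖_; _◃_)
import Data.Integer.Properties as ℤ
open import Data.List.Base using ([]; _∷_)
open import Data.List.Relation.Unary.All using ([]; _∷_)
open import Data.Maybe.Base using (just; nothing; fromMaybe)
open import Data.Nat.Base as ℕ using (ℕ; zero; suc; z≤n; s≤s)
import Data.Nat.Properties as ℕ
open import Data.Product.Base using (_,_; ∃; ∃-syntax; proj₁; proj₂)
open import Data.Rational.Base as ℚ using (ℚ; 0ℚ; 1ℚ; toℚᵘ)
import Data.Rational.Properties as ℚ
open import Data.Rational.Unnormalised.Base as ℚᵘ using (ℚᵘ; mkℚᵘ)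
import Data.Sign.Base as Sign
open import Data.Sum.Base as Sum using (_⊎_; inj₁; inj₂)
open import Data.Sum.Properties using (inj₂-injective)
open import Data.Vec.Base using (Vec; []; _∷_)
open import Function.Base using (_∘_)
open import Function.Bundles using (_⇔_; mk⇔; module Inverse)
open import Function.Construct.Identity using (↔-id)
open import Relation.Binary.Bundles using (Poset)
import Relation.Binary.PropositionalEquality as ≡
open ≡ using (_≡_; _≢_)
import Relation.Binary.Reasoning.PartialOrder as PartialOrderReasoning
open import Relation.Binary.Structures using (IsDecTotalOrder)
open import Relation.Nullary using (¬_; Dec; yes; no; does; ¬?; contradiction)
open import Relation.Nullary.Decidable using (dec-false; dec-true; decidable-stable; map′)
open import Relation.Unary using (Pred)
open import Defs

-- Rewards are built from suprema. The first-step equations of a chain may have several solutions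
-- when a run can avoid the targets forever, so comparing the equations of the two models would not
-- settle the rewards. The comparison is therefore made for each exact number of steps:
-- `ℙ◇⁼ (suc k)` for `fin` in N is a finite combination of the values `ℙ◇⁼ k` for the targets of M,
-- which is an induction on `k`. Only afterwards are the series summed. Exchanging suprema with
-- finite sums and with factors relies on nonnegative terms; this is where lowest weight 0 enters.
-- Division by the largest weight then keeps the lottery probabilities in [0,1]. The fresh
-- transitions are constants, so both models have the same graph-preserving valuations. Since `⊴`
-- carries its maxima as witnesses, no maximum has to be constructed from scratch: a given one is
-- scaled, by `κ` towards N and by `r` back to M.

-- Arithmetic of ordered fields.

module OrderedField (ℝ : CompleteOrderedField) where
  open CompleteOrderedField ℝ
  open IsDecTotalOrder isDecTotalOrder public
    using (antisym; isPartialOrder)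
    renaming (_≟_ to _≈?_; total to ≤-total; refl to ≤-refl; reflexive to ≤-reflexive;
              trans to ≤-trans; ≤-respˡ-≈ to ≤-respˡ; ≤-respʳ-≈ to ≤-respʳ)
  open RingProperties ring public
    using (-‿distribˡ-*; -‿distribʳ-*; -‿involutive; -‿+-comm; -0#≈0#)
  open CommutativeSemigroupProperties *-commutativeSemigroup public
    using () renaming (interchange to *-interchange; x∙yz≈y∙xz to x*yz≈y*xz; xy∙z≈xz∙y to xy*z≈xz*y)
  open CommutativeSemigroupProperties +-commutativeSemigroup public
    using () renaming (interchange to +-interchange; x∙yz≈y∙xz to x+yz≈y+xz)
  open Mult semiring public using (×-homo-+; ×1-homo-*)

  poset : Poset 0ℓ 0ℓ 0ℓ
  poset = record { isPartialOrder = isPartialOrder }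

  module ≤-Reasoning = PartialOrderReasoning poset
  open ≤-Reasoning

  +-monoˡ-≤ : ∀ z {x y} → x ≤ y → x + z ≤ y + z
  +-monoˡ-≤ z {x} {y} x≤y = begin
    x + z ≈⟨ +-comm x z ⟩
    z + x ≤⟨ +-monoʳ-≤ z x≤y ⟩
    z + y ≈⟨ +-comm z y ⟩
    y + z ∎

  +-mono-≤ : ∀ {x y u v} → x ≤ y → u ≤ v → x + u ≤ y + v
  +-mono-≤ {y = y} {u} x≤y u≤v = ≤-trans (+-monoˡ-≤ u x≤y) (+-monoʳ-≤ y u≤v)

  [x-y]+y≈x : ∀ x y → (x - y) + y ≈ x
  [x-y]+y≈x x y = begin-equality
    (x - y) + y   ≈⟨ +-assoc x (- y) y ⟩
    x + (- y + y) ≈⟨ +-congˡ (-‿inverseˡ y) ⟩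
    x + 0#        ≈⟨ +-identityʳ x ⟩
    x             ∎

  -- Together with its converse this moves a summand across an inequality, so that the
  -- least-upper-bound property can be applied to the other summand alone.
  x+y≤z⇒x≤z-y : ∀ {x y z} → x + y ≤ z → x ≤ z - y
  x+y≤z⇒x≤z-y {x} {y} {z} x+y≤z = begin
    x           ≈⟨ +-identityʳ x ⟨
    x + 0#      ≈⟨ +-congˡ (-‿inverseʳ y) ⟨
    x + (y - y) ≈⟨ +-assoc x y (- y) ⟨
    x + y - y   ≤⟨ +-monoˡ-≤ (- y) x+y≤z ⟩
    z - y       ∎

  x≤z-y⇒x+y≤z : ∀ {x y z} → x ≤ z - y → x + y ≤ z
  x≤z-y⇒x+y≤z {x} {y} {z} x≤z-y = begin
    x + y       ≤⟨ +-monoˡ-≤ y x≤z-y ⟩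
    (z - y) + y ≈⟨ [x-y]+y≈x z y ⟩
    z           ∎

  x≤y⇒0≤y-x : ∀ {x y} → x ≤ y → 0# ≤ y - x
  x≤y⇒0≤y-x x≤y = x+y≤z⇒x≤z-y (≤-respˡ (sym (+-identityˡ _)) x≤y)

  0≤y-x⇒x≤y : ∀ {x y} → 0# ≤ y - x → x ≤ y
  0≤y-x⇒x≤y 0≤y-x = ≤-respˡ (+-identityˡ _) (x≤z-y⇒x+y≤z 0≤y-x)

  x≤0⇒0≤-x : ∀ {x} → x ≤ 0# → 0# ≤ - x
  x≤0⇒0≤-x x≤0 = ≤-respʳ (+-identityˡ _) (x≤y⇒0≤y-x x≤0)

  *-monoˡ-≤ : ∀ {x y z} → 0# ≤ x → y ≤ z → x * y ≤ x * z
  *-monoˡ-≤ {x} {y} {z} 0≤x y≤z = 0≤y-x⇒x≤y (begin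
    0#                ≤⟨ *-nonneg 0≤x (x≤y⇒0≤y-x y≤z) ⟩
    x * (z - y)       ≈⟨ distribˡ x z (- y) ⟩
    x * z + x * - y   ≈⟨ +-congˡ (-‿distribʳ-* x y) ⟨
    x * z - x * y     ∎)

  *-monoʳ-≤ : ∀ {x y z} → 0# ≤ x → y ≤ z → y * x ≤ z * x
  *-monoʳ-≤ {x} {y} {z} 0≤x y≤z = begin
    y * x ≈⟨ *-comm y x ⟩
    x * y ≤⟨ *-monoˡ-≤ 0≤x y≤z ⟩
    x * z ≈⟨ *-comm x z ⟩
    z * x ∎

  +-nonneg : ∀ {x y} → 0# ≤ x → 0# ≤ y → 0# ≤ x + y
  +-nonneg 0≤x 0≤y = ≤-respˡ (+-identityˡ 0#) (+-mono-≤ 0≤x 0≤y)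

  0≤1 : 0# ≤ 1#
  0≤1 with ≤-total 0# 1#
  ... | inj₁ 0≤1 = 0≤1
  ... | inj₂ 1≤0 = begin
    0#              ≤⟨ *-nonneg (x≤0⇒0≤-x 1≤0) (x≤0⇒0≤-x 1≤0) ⟩
    - 1# * - 1#     ≈⟨ -‿distribˡ-* 1# (- 1#) ⟨
    - (1# * - 1#)   ≈⟨ -‿cong (*-identityˡ (- 1#)) ⟩
    - - 1#          ≈⟨ -‿involutive 1# ⟩
    1#              ∎

  ×1-nonneg : ∀ n → 0# ≤ n ×ℕ 1#
  ×1-nonneg zero    = ≤-refl
  ×1-nonneg (suc n) = +-nonneg 0≤1 (×1-nonneg n)

  -- The order forces characteristic 0; this is what makes every denominator of a rational
  -- invertible.
  1+n×1≉0 : ∀ n → ¬ (suc n ×ℕ 1# ≈ 0#)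
  1+n×1≉0 n 1+n≈0 = 0≉1 (antisym 0≤1 (begin
    1#           ≈⟨ +-identityʳ 1# ⟨
    1# + 0#      ≤⟨ +-monoʳ-≤ 1# (×1-nonneg n) ⟩
    suc n ×ℕ 1#  ≈⟨ 1+n≈0 ⟩
    0#           ∎))

  *-inverseˡ : ∀ {x} → ¬ (x ≈ 0#) → x ⁻¹ * x ≈ 1#
  *-inverseˡ {x} x≉0 = trans (*-comm (x ⁻¹) x) (*-inverseʳ x≉0)

  *-cancelˡ-⁻¹ : ∀ {x} → ¬ (x ≈ 0#) → ∀ y → x ⁻¹ * (x * y) ≈ y
  *-cancelˡ-⁻¹ {x} x≉0 y = begin-equality
    x ⁻¹ * (x * y) ≈⟨ *-assoc (x ⁻¹) x y ⟨
    x ⁻¹ * x * y   ≈⟨ *-congʳ (*-inverseˡ x≉0) ⟩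
    1# * y         ≈⟨ *-identityˡ y ⟩
    y              ∎

  *-cancelʳ : ∀ {x y z} → ¬ (x ≈ 0#) → y * x ≈ z * x → y ≈ z
  *-cancelʳ {x} {y} {z} x≉0 yx≈zx = begin-equality
    y              ≈⟨ *-cancelˡ-⁻¹ x≉0 y ⟨
    x ⁻¹ * (x * y) ≈⟨ *-congˡ (trans (*-comm x y) (trans yx≈zx (*-comm z x))) ⟩
    x ⁻¹ * (x * z) ≈⟨ *-cancelˡ-⁻¹ x≉0 z ⟩
    z              ∎

  ⁻¹-nonneg : ∀ {x} → 0# ≤ x → ¬ (x ≈ 0#) → 0# ≤ x ⁻¹
  ⁻¹-nonneg {x} 0≤x x≉0 with ≤-total 0# (x ⁻¹)
  ... | inj₁ 0≤x⁻¹ = 0≤x⁻¹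
  ... | inj₂ x⁻¹≤0 = contradiction (antisym 0≤1 (≤-respʳ (zeroʳ x) (begin
    1#             ≈⟨ *-inverseʳ x≉0 ⟨
    x * x ⁻¹       ≤⟨ *-monoˡ-≤ 0≤x x⁻¹≤0 ⟩
    x * 0#         ∎))) 0≉1

  -- The embeddings of integers and rationals are homomorphisms.

  fromℤ-⊖ : ∀ m n → fromℤ (m ⊖ n) ≈ m ×ℕ 1# - n ×ℕ 1#
  fromℤ-⊖ m       zero    = sym (trans (+-congˡ -0#≈0#) (+-identityʳ _))
  fromℤ-⊖ zero    (suc n) = sym (+-identityˡ _)
  fromℤ-⊖ (suc m) (suc n) = begin-equality
    fromℤ (suc m ⊖ suc n)              ≡⟨ ≡.cong fromℤ (ℤ.[1+m]⊖[1+n]≡m⊖n m n) ⟩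
    fromℤ (m ⊖ n)                      ≈⟨ fromℤ-⊖ m n ⟩
    M - N                              ≈⟨ +-identityˡ (M - N) ⟨
    0# + (M - N)                       ≈⟨ +-congʳ (-‿inverseʳ 1#) ⟨
    (1# - 1#) + (M - N)                ≈⟨ +-interchange 1# (- 1#) M (- N) ⟩
    (1# + M) + (- 1# - N)              ≈⟨ +-congˡ (-‿+-comm 1# N) ⟩
    (1# + M) - (1# + N)                ∎
    where
    M = m ×ℕ 1#
    N = n ×ℕ 1#

  fromℤ-+ : ∀ i j → fromℤ (i ℤ.+ j) ≈ fromℤ i + fromℤ j
  fromℤ-+ (+ m)    (+ n)    = ×-homo-+ 1# m n
  fromℤ-+ (+ m)    -[1+ n ] = fromℤ-⊖ m (suc n)
  fromℤ-+ -[1+ m ] (+ n)    = trans (fromℤ-⊖ n (suc m)) (+-comm _ _)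
  fromℤ-+ -[1+ m ] -[1+ n ] = begin-equality
    - (1# + (1# + (m ℕ.+ n) ×ℕ 1#)) ≈⟨ -‿cong (+-congˡ (+-congˡ (×-homo-+ 1# m n))) ⟩
    - (1# + (1# + (M + N)))         ≈⟨ -‿cong (+-congˡ (x+yz≈y+xz 1# M N)) ⟩
    - (1# + (M + (1# + N)))         ≈⟨ -‿cong (+-assoc 1# M (1# + N)) ⟨
    - ((1# + M) + (1# + N))         ≈⟨ -‿+-comm (1# + M) (1# + N) ⟨
    - (1# + M) - (1# + N)           ∎
    where
    M = m ×ℕ 1#
    N = n ×ℕ 1#

  fromℤ-◃- : ∀ n → fromℤ (Sign.- ◃ n) ≈ - (n ×ℕ 1#)
  fromℤ-◃- zero    = sym -0#≈0#
  fromℤ-◃- (suc n) = refl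

  fromℤ-◃+ : ∀ n → fromℤ (Sign.+ ◃ n) ≈ n ×ℕ 1#
  fromℤ-◃+ zero    = refl
  fromℤ-◃+ (suc n) = refl

  fromℤ-* : ∀ i j → fromℤ (i ℤ.* j) ≈ fromℤ i * fromℤ j
  fromℤ-* (+ m)    (+ n)    = trans (fromℤ-◃+ (m ℕ.* n)) (×1-homo-* m n)
  fromℤ-* (+ m)    -[1+ n ] = begin-equality
    fromℤ (Sign.- ◃ m ℕ.* suc n)   ≈⟨ fromℤ-◃- (m ℕ.* suc n) ⟩
    - ((m ℕ.* suc n) ×ℕ 1#)        ≈⟨ -‿cong (×1-homo-* m (suc n)) ⟩
    - (m ×ℕ 1# * (suc n ×ℕ 1#))    ≈⟨ -‿distribʳ-* _ _ ⟩
    m ×ℕ 1# * - (suc n ×ℕ 1#)      ∎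
  fromℤ-* -[1+ m ] (+ n)    = begin-equality
    fromℤ (Sign.- ◃ suc m ℕ.* n)   ≈⟨ fromℤ-◃- (suc m ℕ.* n) ⟩
    - ((suc m ℕ.* n) ×ℕ 1#)        ≈⟨ -‿cong (×1-homo-* (suc m) n) ⟩
    - ((suc m ×ℕ 1#) * (n ×ℕ 1#))  ≈⟨ -‿distribˡ-* _ _ ⟩
    - (suc m ×ℕ 1#) * (n ×ℕ 1#)    ∎
  fromℤ-* -[1+ m ] -[1+ n ] = begin-equality
    (suc m ℕ.* suc n) ×ℕ 1#              ≈⟨ ×1-homo-* (suc m) (suc n) ⟩
    (suc m ×ℕ 1#) * (suc n ×ℕ 1#)        ≈⟨ -‿involutive _ ⟨
    - - ((suc m ×ℕ 1#) * (suc n ×ℕ 1#))  ≈⟨ -‿cong (-‿distribˡ-* _ _) ⟩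
    - (- (suc m ×ℕ 1#) * (suc n ×ℕ 1#))  ≈⟨ -‿distribʳ-* _ _ ⟩
    - (suc m ×ℕ 1#) * - (suc n ×ℕ 1#)    ∎

  -- Arithmetic on `ℚ` reduces fractions to lowest terms, which hides numerators and denominators.
  -- On unnormalised fractions they are given by the schoolbook formulas, so the homomorphism laws
  -- are proved there and transported along `toℚᵘ`.
  fromℚᵘ : ℚᵘ → Carrier
  fromℚᵘ p = fromℤ (ℚᵘ.↥ p) * (ℚᵘ.↧ₙ p ×ℕ 1#) ⁻¹

  fromℚᵘ-↧ : ∀ p → fromℚᵘ p * fromℤ (ℚᵘ.↧ p) ≈ fromℤ (ℚᵘ.↥ p)
  fromℚᵘ-↧ (mkℚᵘ i d) = begin-equality
    fromℤ i * D ⁻¹ * D   ≈⟨ *-assoc (fromℤ i) (D ⁻¹) D ⟩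
    fromℤ i * (D ⁻¹ * D) ≈⟨ *-congˡ (*-inverseˡ (1+n×1≉0 d)) ⟩
    fromℤ i * 1#         ≈⟨ *-identityʳ (fromℤ i) ⟩
    fromℤ i              ∎
    where D = suc d ×ℕ 1#

  -- This universal property of a fraction replaces calculations with inverses: each law below
  -- becomes an identity between images of integers.
  fromℚᵘ-unique : ∀ p {x} → x * fromℤ (ℚᵘ.↧ p) ≈ fromℤ (ℚᵘ.↥ p) → x ≈ fromℚᵘ p
  fromℚᵘ-unique p x*↧≈↥ =
    *-cancelʳ (1+n×1≉0 (ℚᵘ.denominator-1 p)) (trans x*↧≈↥ (sym (fromℚᵘ-↧ p)))

  fromℚᵘ-cong : ∀ {p q} → p ℚᵘ.≃ q → fromℚᵘ p ≈ fromℚᵘ q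
  fromℚᵘ-cong {p} {q} (ℚᵘ.*≡* ↥p*↧q≡↥q*↧p) =
    fromℚᵘ-unique q (*-cancelʳ (1+n×1≉0 (ℚᵘ.denominator-1 p)) (begin-equality
      P * fromℤ (ℚᵘ.↧ q) * fromℤ (ℚᵘ.↧ p) ≈⟨ xy*z≈xz*y P _ _ ⟩
      P * fromℤ (ℚᵘ.↧ p) * fromℤ (ℚᵘ.↧ q) ≈⟨ *-congʳ (fromℚᵘ-↧ p) ⟩
      fromℤ (ℚᵘ.↥ p) * fromℤ (ℚᵘ.↧ q)     ≈⟨ fromℤ-* (ℚᵘ.↥ p) (ℚᵘ.↧ q) ⟨
      fromℤ (ℚᵘ.↥ p ℤ.* ℚᵘ.↧ q)           ≡⟨ ≡.cong fromℤ ↥p*↧q≡↥q*↧p ⟩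
      fromℤ (ℚᵘ.↥ q ℤ.* ℚᵘ.↧ p)           ≈⟨ fromℤ-* (ℚᵘ.↥ q) (ℚᵘ.↧ p) ⟩
      fromℤ (ℚᵘ.↥ q) * fromℤ (ℚᵘ.↧ p)     ∎))
    where P = fromℚᵘ p

  fromℚᵘ-* : ∀ p q → fromℚᵘ (p ℚᵘ.* q) ≈ fromℚᵘ p * fromℚᵘ q
  fromℚᵘ-* p@(mkℚᵘ i c) q@(mkℚᵘ j d) = sym (fromℚᵘ-unique (p ℚᵘ.* q) (begin-equality
    P * Q * fromℤ (ℚᵘ.↧ p ℤ.* ℚᵘ.↧ q)   ≈⟨ *-congˡ (fromℤ-* (ℚᵘ.↧ p) (ℚᵘ.↧ q)) ⟩
    P * Q * (C * D)                     ≈⟨ *-interchange P Q C D ⟩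
    P * C * (Q * D)                     ≈⟨ *-cong (fromℚᵘ-↧ p) (fromℚᵘ-↧ q) ⟩
    fromℤ i * fromℤ j                   ≈⟨ fromℤ-* i j ⟨
    fromℤ (i ℤ.* j)                     ∎))
    where
    P = fromℚᵘ p
    Q = fromℚᵘ q
    C = fromℤ (ℚᵘ.↧ p)
    D = fromℤ (ℚᵘ.↧ q)

  fromℚᵘ-+ : ∀ p q → fromℚᵘ (p ℚᵘ.+ q) ≈ fromℚᵘ p + fromℚᵘ q
  fromℚᵘ-+ p@(mkℚᵘ i c) q@(mkℚᵘ j d) = sym (fromℚᵘ-unique (p ℚᵘ.+ q) (begin-equality
    (P + Q) * fromℤ (ℚᵘ.↧ p ℤ.* ℚᵘ.↧ q)  ≈⟨ *-congˡ (fromℤ-* (ℚᵘ.↧ p) (ℚᵘ.↧ q)) ⟩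
    (P + Q) * (C * D)                    ≈⟨ distribʳ (C * D) P Q ⟩
    P * (C * D) + Q * (C * D)            ≈⟨ +-congˡ (*-congˡ (*-comm C D)) ⟩
    P * (C * D) + Q * (D * C)            ≈⟨ +-cong (*-assoc P C D) (*-assoc Q D C) ⟨
    P * C * D + Q * D * C                ≈⟨ +-cong (*-congʳ (fromℚᵘ-↧ p)) (*-congʳ (fromℚᵘ-↧ q)) ⟩
    fromℤ i * D + fromℤ j * C            ≈⟨ +-cong (fromℤ-* i (ℚᵘ.↧ q)) (fromℤ-* j (ℚᵘ.↧ p)) ⟨
    fromℤ (i ℤ.* ℚᵘ.↧ q) + fromℤ (j ℤ.* ℚᵘ.↧ p) ≈⟨ fromℤ-+ (i ℤ.* ℚᵘ.↧ q) (j ℤ.* ℚᵘ.↧ p) ⟨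
    fromℤ (i ℤ.* ℚᵘ.↧ q ℤ.+ j ℤ.* ℚᵘ.↧ p) ∎))
    where
    P = fromℚᵘ p
    Q = fromℚᵘ q
    C = fromℤ (ℚᵘ.↧ p)
    D = fromℤ (ℚᵘ.↧ q)

  fromℚ-toℚᵘ : ∀ p → fromℚ p ≡ fromℚᵘ (toℚᵘ p)
  fromℚ-toℚᵘ (ℚ.mkℚ _ _ _) = ≡.refl

  fromℚ-* : ∀ p q → fromℚ (p ℚ.* q) ≈ fromℚ p * fromℚ q
  fromℚ-* p q = begin-equality
    fromℚ (p ℚ.* q)                       ≡⟨ fromℚ-toℚᵘ (p ℚ.* q) ⟩
    fromℚᵘ (toℚᵘ (p ℚ.* q))               ≈⟨ fromℚᵘ-cong (ℚ.toℚᵘ-homo-* p q) ⟩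
    fromℚᵘ (toℚᵘ p ℚᵘ.* toℚᵘ q)           ≈⟨ fromℚᵘ-* (toℚᵘ p) (toℚᵘ q) ⟩
    fromℚᵘ (toℚᵘ p) * fromℚᵘ (toℚᵘ q)     ≡⟨ ≡.cong₂ _*_ (fromℚ-toℚᵘ p) (fromℚ-toℚᵘ q) ⟨
    fromℚ p * fromℚ q                     ∎

  fromℚ-+ : ∀ p q → fromℚ (p ℚ.+ q) ≈ fromℚ p + fromℚ q
  fromℚ-+ p q = begin-equality
    fromℚ (p ℚ.+ q)                       ≡⟨ fromℚ-toℚᵘ (p ℚ.+ q) ⟩
    fromℚᵘ (toℚᵘ (p ℚ.+ q))               ≈⟨ fromℚᵘ-cong (ℚ.toℚᵘ-homo-+ p q) ⟩
    fromℚᵘ (toℚᵘ p ℚᵘ.+ toℚᵘ q)           ≈⟨ fromℚᵘ-+ (toℚᵘ p) (toℚᵘ q) ⟩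
    fromℚᵘ (toℚᵘ p) + fromℚᵘ (toℚᵘ q)     ≡⟨ ≡.cong₂ _+_ (fromℚ-toℚᵘ p) (fromℚ-toℚᵘ q) ⟨
    fromℚ p + fromℚ q                     ∎

  fromℚ-0 : fromℚ 0ℚ ≈ 0#
  fromℚ-0 = zeroˡ _

  fromℚ-1 : fromℚ 1ℚ ≈ 1#
  fromℚ-1 = sym (fromℚᵘ-unique ℚᵘ.1ℚᵘ (*-identityˡ _))

  -- A nonzero rational has a rational reciprocal, and multiplicativity would turn a zero image into
  -- `0# ≈ 1#`.
  fromℚ-≉0 : ∀ p → ¬ (p ≡ 0ℚ) → ¬ (fromℚ p ≈ 0#)
  fromℚ-≉0 p p≢0 p≈0 = 0≉1 (begin-equality
    0#                       ≈⟨ zeroˡ _ ⟨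
    0# * fromℚ (ℚ.1/ p)      ≈⟨ *-congʳ p≈0 ⟨
    fromℚ p * fromℚ (ℚ.1/ p) ≈⟨ fromℚ-* p (ℚ.1/ p) ⟨
    fromℚ (p ℚ.* ℚ.1/ p)     ≡⟨ ≡.cong fromℚ (ℚ.*-inverseʳ p) ⟩
    fromℚ 1ℚ                 ≈⟨ fromℚ-1 ⟩
    1#                       ∎)
    where instance _ = ℚ.≢-nonZero p≢0

  fromℚ-nonneg : ∀ p → 0ℚ ℚ.≤ p → 0# ≤ fromℚ p
  fromℚ-nonneg (ℚ.mkℚ (+ n) d _) _ =
    *-nonneg (×1-nonneg n) (⁻¹-nonneg (×1-nonneg (suc d)) (1+n×1≉0 d))
  fromℚ-nonneg p@(ℚ.mkℚ -[1+ _ ] _ _) 0≤p with () ← ℤ.NonNegative.nonNeg (ℚ.nonNegative {p} 0≤p)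

-- Finite sums and series of nonnegative terms.

module Series (ℝ : CompleteOrderedField) where
  open CompleteOrderedField ℝ
  open OrderedField ℝ
  open ≤-Reasoning
  open SemiringSum semiring
    using (sum-cong-≋; ∑-distrib-+; ∑-comm; sum-replicate-zero; *-distribˡ-sum)

  sum-mono : ∀ {n} {f g : Fin n → Carrier} → (∀ i → f i ≤ g i) → sum f ≤ sum g
  sum-mono {zero}  f≤g = ≤-refl
  sum-mono {suc n} f≤g = +-mono-≤ (f≤g Fin.zero) (sum-mono (f≤g ∘ Fin.suc))

  sum-zero : ∀ {n} {f : Fin n → Carrier} → (∀ i → f i ≈ 0#) → sum f ≈ 0#
  sum-zero {n} f≈0 = trans (sum-cong-≋ f≈0) (sum-replicate-zero n)

  sum-nonneg : ∀ {n} {f : Fin n → Carrier} → (∀ i → 0# ≤ f i) → 0# ≤ sum f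
  sum-nonneg {n} 0≤f = ≤-respˡ (sum-replicate-zero n) (sum-mono 0≤f)

  sum-single : ∀ {n} (f : Fin n → Carrier) i → (∀ j → j ≢ i → f j ≈ 0#) → sum f ≈ f i
  sum-single f Fin.zero    f≈0 =
    trans (+-congˡ (sum-zero (λ j → f≈0 (Fin.suc j) λ ()))) (+-identityʳ _)
  sum-single f (Fin.suc i) f≈0 = trans
    (+-cong (f≈0 Fin.zero λ ())
            (sum-single (f ∘ Fin.suc) i λ j j≢i → f≈0 (Fin.suc j) (j≢i ∘ Fin.suc-injective)))
    (+-identityˡ _)

  sum-split : ∀ m {n} (f : Fin (m ℕ.+ n) → Carrier) →
              sum f ≈ sum (f ∘ (_↑ˡ n)) + sum (f ∘ (m ↑ʳ_))
  sum-split zero    f = sym (+-identityˡ _)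
  sum-split (suc m) f = trans (+-congˡ (sum-split m (f ∘ Fin.suc))) (sym (+-assoc _ _ _))

  -- Definitionally the sum of `Semantics`, but independent of a model, so that the lemmas below
  -- serve M and N alike.
  ∑ : ∀ {B} → Finite B → (B → Carrier) → Carrier
  ∑ (_ , e) f = sum (f ∘ Inverse.to e)

  module _ {B : Set} (F : Finite B) where

    ∑-cong : ∀ {f g : B → Carrier} → (∀ b → f b ≈ g b) → ∑ F f ≈ ∑ F g
    ∑-cong f≈g = sum-cong-≋ (f≈g ∘ Inverse.to (proj₂ F))

    ∑-mono : ∀ {f g : B → Carrier} → (∀ b → f b ≤ g b) → ∑ F f ≤ ∑ F g
    ∑-mono f≤g = sum-mono (f≤g ∘ Inverse.to (proj₂ F))

    ∑-nonneg : ∀ {f : B → Carrier} → (∀ b → 0# ≤ f b) → 0# ≤ ∑ F f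
    ∑-nonneg 0≤f = sum-nonneg (0≤f ∘ Inverse.to (proj₂ F))

    ∑-zero : ∀ {f : B → Carrier} → (∀ b → f b ≈ 0#) → ∑ F f ≈ 0#
    ∑-zero f≈0 = sum-zero (f≈0 ∘ Inverse.to (proj₂ F))

    ∑-*ˡ : ∀ x (f : B → Carrier) → x * ∑ F f ≈ ∑ F (λ b → x * f b)
    ∑-*ˡ x f = *-distribˡ-sum x (f ∘ Inverse.to (proj₂ F))

    ∑-swap : ∀ {C} (G : Finite C) (f : B → C → Carrier) →
             ∑ F (λ b → ∑ G (f b)) ≈ ∑ G (λ c → ∑ F (λ b → f b c))
    ∑-swap G f = ∑-comm λ i j → f (Inverse.to (proj₂ F) i) (Inverse.to (proj₂ G) j)

    ∑-⊎ : ∀ {C} (G : Finite C) (f : B ⊎ C → Carrier) →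
          ∑ (finite-⊎ F G) f ≈ ∑ F (f ∘ inj₁) + ∑ G (f ∘ inj₂)
    ∑-⊎ G f = trans (sum-split (proj₁ F) _) (+-cong
      (sum-cong-≋ λ i → reflexive (≡.cong (f ∘ h) (Fin.splitAt-↑ˡ (proj₁ F) i (proj₁ G))))
      (sum-cong-≋ λ j → reflexive (≡.cong (f ∘ h) (Fin.splitAt-↑ʳ (proj₁ F) (proj₁ G) j))))
      where
      h = Sum.map (Inverse.to (proj₂ F)) (Inverse.to (proj₂ G))

    ∑-single : ∀ (f : B → Carrier) b → (∀ b′ → b′ ≢ b → f b′ ≈ 0#) → ∑ F f ≈ f b
    ∑-single f b f≈0 = trans
      (sum-single (f ∘ to) (from b) λ j j≢ →
        f≈0 (to j) λ to-j≡b → j≢ (≡.trans (≡.sym (strictlyInverseʳ j)) (≡.cong from to-j≡b)))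
      (reflexive (≡.cong f (strictlyInverseˡ b)))
      where open Inverse (proj₂ F)

  partialSum : (ℕ → Carrier) → ℕ → Carrier
  partialSum a n = sum {n} (a ∘ toℕ)

  partialSum-mono : ∀ {a} → (∀ k → 0# ≤ a k) → ∀ {m n} → m ℕ.≤ n → partialSum a m ≤ partialSum a n
  partialSum-mono 0≤a {n = n} z≤n = sum-nonneg {n} (0≤a ∘ toℕ)
  partialSum-mono 0≤a (s≤s m≤n)   = +-monoʳ-≤ _ (partialSum-mono (0≤a ∘ suc) m≤n)

  -- For nonnegative a: the series a₀ + a₁ + … converges to s.
  record HasSum (a : ℕ → Carrier) (s : Carrier) : Set where
    constructor _,_
    field
      upper : ∀ n → partialSum a n ≤ s
      least : ∀ {b} → (∀ n → partialSum a n ≤ b) → s ≤ b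

  -- `sup` is specified only for nonempty bounded sets. The empty partial sum settles the first
  -- condition, and the bound has to be supplied. The predicate is the one under `sup` in the
  -- definition of `ℙ◇`.
  HasSum-sup : ∀ a {b} → (∀ n → partialSum a n ≤ b) →
               HasSum a (sup (λ x → ∃[ n ] x ≈ partialSum a n))
  HasSum-sup a {b} a≤b =
    (λ n → sup-upper nonempty (b , λ { (m , x≈) → ≤-respˡ (sym x≈) (a≤b m) }) (n , refl)) ,
    (λ a≤c → sup-least nonempty λ { (m , x≈) → ≤-respˡ (sym x≈) (a≤c m) })
    where
    nonempty : ∃ λ x → ∃[ n ] x ≈ partialSum a n
    nonempty = 0# , 0 , refl

  HasSum-mono : ∀ {a b x y} → (∀ k → a k ≤ b k) → HasSum a x → HasSum b y → x ≤ y
  HasSum-mono a≤b (_ , x-least) (y-upper , _) =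
    x-least λ n → ≤-trans (sum-mono {n} (a≤b ∘ toℕ)) (y-upper n)

  HasSum-cong : ∀ {a b x} → (∀ k → a k ≈ b k) → HasSum a x → HasSum b x
  HasSum-cong {a} {b} a≈b (upper , least) =
    (λ n → ≤-respˡ (partialSum-cong n) (upper n)) ,
    (λ b≤c → least λ n → ≤-respˡ (sym (partialSum-cong n)) (b≤c n))
    where
    partialSum-cong : ∀ n → partialSum a n ≈ partialSum b n
    partialSum-cong n = sum-cong-≋ {n} (a≈b ∘ toℕ)

  HasSum-unique : ∀ {a x y} → HasSum a x → HasSum a y → x ≈ y
  HasSum-unique (x-upper , x-least) (y-upper , y-least) = antisym (x-least y-upper) (y-least x-upper)

  HasSum-zero : HasSum (λ _ → 0#) 0#
  HasSum-zero = (λ n → ≤-reflexive (sum-replicate-zero n)) , (λ 0≤b → 0≤b 0)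

  -- Absorbs the delay of one step between the runs of M and those of N.
  HasSum-suc : ∀ {a x} → a 0 ≈ 0# → HasSum (a ∘ suc) x → HasSum a x
  HasSum-suc {a} {x} a₀≈0 (upper , least) = upper′ , least′
    where
    partialSum-suc : ∀ n → partialSum a (suc n) ≈ partialSum (a ∘ suc) n
    partialSum-suc n = trans (+-congʳ a₀≈0) (+-identityˡ _)
    upper′ : ∀ n → partialSum a n ≤ x
    upper′ zero    = upper 0
    upper′ (suc n) = ≤-respˡ (sym (partialSum-suc n)) (upper n)
    least′ : ∀ {b} → (∀ n → partialSum a n ≤ b) → x ≤ b
    least′ a≤b = least λ n → ≤-respˡ (partialSum-suc n) (a≤b (suc n))

  HasSum-* : ∀ {a x c} → 0# ≤ c → HasSum a x → HasSum (λ k → c * a k) (c * x)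
  HasSum-* {a} {x} {c} 0≤c (upper , least) =
    (λ n → ≤-respˡ (partialSum-* n) (*-monoˡ-≤ 0≤c (upper n))) , least′
    where
    partialSum-* : ∀ n → c * partialSum a n ≈ partialSum (λ k → c * a k) n
    partialSum-* n = *-distribˡ-sum {n} c (a ∘ toℕ)
    least′ : ∀ {b} → (∀ n → partialSum (λ k → c * a k) n ≤ b) → c * x ≤ b
    least′ {b} ca≤b with c ≈? 0#
    -- There is no inverse to divide by, but the empty partial sum already gives `0# ≤ b`.
    ... | yes c≈0 = ≤-respˡ (trans (sym (zeroˡ x)) (*-congʳ (sym c≈0))) (ca≤b 0)
    ... | no  c≉0 = begin
      c * x            ≤⟨ *-monoˡ-≤ 0≤c (least λ n → begin
        partialSum a n                        ≈⟨ *-cancelˡ-⁻¹ c≉0 _ ⟨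
        c ⁻¹ * (c * partialSum a n)           ≈⟨ *-congˡ (partialSum-* n) ⟩
        c ⁻¹ * partialSum (λ k → c * a k) n   ≤⟨ *-monoˡ-≤ (⁻¹-nonneg 0≤c c≉0) (ca≤b n) ⟩
        c ⁻¹ * b                              ∎) ⟩
      c * (c ⁻¹ * b)   ≈⟨ x*yz≈y*xz c (c ⁻¹) b ⟩
      c ⁻¹ * (c * b)   ≈⟨ *-cancelˡ-⁻¹ c≉0 b ⟩
      b                ∎

  -- The two suprema are taken one after the other, so partial sums of different lengths `m` and `n`
  -- have to be bounded jointly. Nonnegative terms make partial sums increase, and the common length
  -- `m + n` dominates both.
  HasSum-+ : ∀ {a b x y} → (∀ k → 0# ≤ a k) → (∀ k → 0# ≤ b k) →
             HasSum a x → HasSum b y → HasSum (λ k → a k + b k) (x + y)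
  HasSum-+ {a} {b} {x} {y} 0≤a 0≤b (x-upper , x-least) (y-upper , y-least) =
    (λ n → ≤-respˡ (sym (partialSum-+ n)) (+-mono-≤ (x-upper n) (y-upper n))) , least
    where
    partialSum-+ : ∀ n → partialSum (λ k → a k + b k) n ≈ partialSum a n + partialSum b n
    partialSum-+ n = ∑-distrib-+ {n} (a ∘ toℕ) (b ∘ toℕ)
    least : ∀ {c} → (∀ n → partialSum (λ k → a k + b k) n ≤ c) → x + y ≤ c
    least {c} a+b≤c = x≤z-y⇒x+y≤z (x-least λ m → x+y≤z⇒x≤z-y (begin
      partialSum a m + y ≈⟨ +-comm _ y ⟩
      y + partialSum a m ≤⟨ x≤z-y⇒x+y≤z (y-least λ n → x+y≤z⇒x≤z-y (begin
        partialSum b n + partialSum a m                 ≈⟨ +-comm _ _ ⟩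
        partialSum a m + partialSum b n                 ≤⟨ +-mono-≤
          (partialSum-mono 0≤a (ℕ.m≤m+n m n)) (partialSum-mono 0≤b (ℕ.m≤n+m n m)) ⟩
        partialSum a (m ℕ.+ n) + partialSum b (m ℕ.+ n) ≈⟨ partialSum-+ (m ℕ.+ n) ⟨
        partialSum (λ k → a k + b k) (m ℕ.+ n)          ≤⟨ a+b≤c (m ℕ.+ n) ⟩
        c                                               ∎)) ⟩
      c ∎))

  HasSum-sum : ∀ {n} {a : Fin n → ℕ → Carrier} {x : Fin n → Carrier} →
               (∀ i k → 0# ≤ a i k) → (∀ i → HasSum (a i) (x i)) →
               HasSum (λ k → sum (λ i → a i k)) (sum x)
  HasSum-sum {zero}  0≤a h = HasSum-zero
  HasSum-sum {suc n} 0≤a h =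
    HasSum-+ (0≤a Fin.zero) (λ k → sum-nonneg (λ i → 0≤a (Fin.suc i) k))
      (h Fin.zero) (HasSum-sum (0≤a ∘ Fin.suc) (h ∘ Fin.suc))

  HasSum-∑ : ∀ {B} (F : Finite B) {a : B → ℕ → Carrier} {x : B → Carrier} →
             (∀ b k → 0# ≤ a b k) → (∀ b → HasSum (a b) (x b)) →
             HasSum (λ k → ∑ F (λ b → a b k)) (∑ F x)
  HasSum-∑ (_ , e) 0≤a h = HasSum-sum (0≤a ∘ Inverse.to e) (h ∘ Inverse.to e)

-- Evaluation of zero and constant polynomials.

module Polynomials (ℝ : CompleteOrderedField) where
  open CompleteOrderedField ℝ
  open OrderedField ℝ
  open ≤-Reasoning

  eval-IsZero : ∀ n {p} → IsZero n p → ∀ val → eval ℝ n p val ≈ 0#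
  eval-IsZero zero    ≡.refl val = fromℚ-0
  eval-IsZero (suc n) []       val = refl
  eval-IsZero (suc n) (z ∷ zs) val = trans
    (+-cong (eval-IsZero n z _) (trans (*-congˡ (eval-IsZero (suc n) zs val)) (zeroʳ _)))
    (+-identityˡ 0#)

  eval-const : ∀ n q val → eval ℝ n (const n q) val ≈ fromℚ q
  eval-const zero    q val = refl
  eval-const (suc n) q val = trans (+-cong (eval-const n q _) (zeroʳ _)) (+-identityʳ _)

  IsZero-const : ∀ n {q} → q ≡ 0ℚ → IsZero n (const n q)
  IsZero-const zero    q≡0 = q≡0
  IsZero-const (suc n) q≡0 = IsZero-const n q≡0 ∷ []

  eval-const-≉0 : ∀ n {q} → ¬ IsZero n (const n q) → ∀ val → ¬ (eval ℝ n (const n q) val ≈ 0#)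
  eval-const-≉0 n {q} nz val ≈0 =
    fromℚ-≉0 q (nz ∘ IsZero-const n) (trans (sym (eval-const n q val)) ≈0)

-- Step-bounded reachability in an arbitrary model.

module Reachability (ℝ : CompleteOrderedField) (M : WPMDP) where
  open CompleteOrderedField ℝ
  open OrderedField ℝ
  open ≤-Reasoning
  open Series ℝ
  open Polynomials ℝ
  open WPMDP M
  open Semantics ℝ M hiding (∑)

  if-*ˡ : ∀ (b : Bool) x y → (if b then x * y else 0#) ≈ x * (if b then y else 0#)
  if-*ˡ true  x y = refl
  if-*ˡ false x y = sym (zeroʳ x)

  module _ (val : Valuation) (σ : Strategy) where
    open Chain val σ hiding (Rew)

    ∑paths-cong : ∀ k {f g : Vec State k → Carrier} → (∀ π → f π ≈ g π) → ∑paths k f ≈ ∑paths k g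
    ∑paths-cong zero    f≈g = f≈g []
    ∑paths-cong (suc k) f≈g = ∑-cong finiteState λ s → ∑paths-cong k (f≈g ∘ (s ∷_))

    ∑paths-*ˡ : ∀ k x (f : Vec State k → Carrier) → x * ∑paths k f ≈ ∑paths k (λ π → x * f π)
    ∑paths-*ˡ zero    x f = refl
    ∑paths-*ˡ (suc k) x f = trans (∑-*ˡ finiteState x (λ s → ∑paths k (f ∘ (s ∷_))))
      (∑-cong finiteState λ s → ∑paths-*ˡ k x (f ∘ (s ∷_)))

    -- The end of a path does not depend on how its first step is weighted, so the factor for that
    -- step can be pulled out of the test and out of the sum over the remaining path.
    ℙ◇⁼-suc : ∀ k s t → ℙ◇⁼ (suc k) s t ≈ ∑ finiteState (λ s′ → step s s′ * ℙ◇⁼ k s′ t)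
    ℙ◇⁼-suc k s t = ∑-cong finiteState λ s′ → trans
      (∑paths-cong k λ π → if-*ˡ (does (end s′ π ≟ inj₂ t)) (step s s′) (cylinder s′ π))
      (sym (∑paths-*ˡ k (step s s′) λ π → if does (end s′ π ≟ inj₂ t) then cylinder s′ π else 0#))

    ℙ◇⁼-suc-target : ∀ k t′ t → ℙ◇⁼ (suc k) (inj₂ t′) t ≈ 0#
    ℙ◇⁼-suc-target k t′ t =
      trans (ℙ◇⁼-suc k (inj₂ t′) t) (∑-zero finiteState λ s′ → zeroˡ (ℙ◇⁼ k s′ t))

    ℙ◇⁼-zero-nonneg : ∀ s t → 0# ≤ ℙ◇⁼ 0 s t
    ℙ◇⁼-zero-nonneg s t with does (s ≟ inj₂ t)
    ... | true  = 0≤1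
    ... | false = ≤-refl

    ℙ◇⁼-zero≤1 : ∀ s t → ℙ◇⁼ 0 s t ≤ 1#
    ℙ◇⁼-zero≤1 s t with does (s ≟ inj₂ t)
    ... | true  = ≤-refl
    ... | false = 0≤1

    ℙ◇⁼-zero-hit : ∀ t → ℙ◇⁼ 0 (inj₂ t) t ≈ 1#
    ℙ◇⁼-zero-hit t = reflexive
      (≡.cong (if_then 1# else 0#) (dec-true (inj₂ t ≟ inj₂ t) ≡.refl))

    ℙ◇⁼-zero-miss : ∀ {s t} → s ≢ inj₂ t → ℙ◇⁼ 0 s t ≈ 0#
    ℙ◇⁼-zero-miss {s} {t} s≢t = reflexive
      (≡.cong (if_then 1# else 0#) (dec-false (s ≟ inj₂ t) s≢t))

  enabled? : ∀ s a → Dec (Enabled s a)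
  enabled? s a = map′
    (λ (i , nz) → to i , nz)
    (λ (s′ , nz) → from s′ , ≡.subst (NonZeroδ s a) (≡.sym (strictlyInverseˡ s′)) nz)
    (Fin.any? λ i → ¬? (isZero? params (δ s a (to i))))
    where open Inverse (proj₂ finiteState)

  module _ {val : Valuation} (gp : GraphPreserving val) where
    open GraphPreserving gp

    -- Only an inequality, because a disabled pair has total mass 0.
    ∑prob≤1 : ∀ s a → ∑ finiteState (prob val s a) ≤ 1#
    ∑prob≤1 s a with enabled? s a
    ... | yes en = ≤-reflexive (total s a en)
    ... | no ¬en = ≤-respˡ (sym (∑-zero finiteState λ s′ → eval-IsZero params
      (decidable-stable (isZero? params (δ s a s′)) λ nz → ¬en (s′ , nz)) val)) 0≤1

    module _ (σ : Strategy) where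
      open Chain val σ hiding (Rew)

      step-nonneg : ∀ s s′ → 0# ≤ step s s′
      step-nonneg (inj₁ s) s′ = nonnegative s (σ s) s′
      step-nonneg (inj₂ _) _  = ≤-refl

      ℙ◇⁼-nonneg : ∀ k s t → 0# ≤ ℙ◇⁼ k s t
      ℙ◇⁼-nonneg zero    s t = ℙ◇⁼-zero-nonneg val σ s t
      ℙ◇⁼-nonneg (suc k) s t = ≤-respʳ (sym (ℙ◇⁼-suc val σ k s t))
        (∑-nonneg finiteState λ s′ → *-nonneg (step-nonneg s s′) (ℙ◇⁼-nonneg k s′ t))

      partialSum-ℙ◇⁼-suc : ∀ n s t → partialSum (λ k → ℙ◇⁼ (suc k) s t) n ≈
                           ∑ finiteState (λ s′ → step s s′ * partialSum (λ k → ℙ◇⁼ k s′ t) n)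
      partialSum-ℙ◇⁼-suc n s t = begin-equality
        partialSum (λ k → ℙ◇⁼ (suc k) s t) n
          ≈⟨ ∑-cong Fin-n (λ k → ℙ◇⁼-suc val σ (toℕ k) s t) ⟩
        ∑ Fin-n (λ k → ∑ finiteState (λ s′ → step s s′ * ℙ◇⁼ (toℕ k) s′ t))
          ≈⟨ ∑-swap Fin-n finiteState (λ k s′ → step s s′ * ℙ◇⁼ (toℕ k) s′ t) ⟩
        ∑ finiteState (λ s′ → ∑ Fin-n (λ k → step s s′ * ℙ◇⁼ (toℕ k) s′ t))
          ≈⟨ ∑-cong finiteState (λ s′ → ∑-*ˡ Fin-n (step s s′) (λ k → ℙ◇⁼ (toℕ k) s′ t)) ⟨
        ∑ finiteState (λ s′ → step s s′ * partialSum (λ k → ℙ◇⁼ k s′ t) n) ∎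
        where
        Fin-n : Finite (Fin n)
        Fin-n = n , ↔-id (Fin n)

      -- The bound that makes the supremum in `ℙ◇` meaningful. An inner state contributes nothing at
      -- step 0 and afterwards a subconvex combination of bounded values; a target can contribute
      -- only at step 0, since its runs stop there.
      partialSum-ℙ◇⁼≤1 : ∀ n s t → partialSum (λ k → ℙ◇⁼ k s t) n ≤ 1#
      partialSum-ℙ◇⁼≤1 zero    s        t = 0≤1
      partialSum-ℙ◇⁼≤1 (suc n) (inj₁ s) t = begin
        0# + partialSum (λ k → ℙ◇⁼ (suc k) (inj₁ s) t) n
          ≈⟨ trans (+-identityˡ _) (partialSum-ℙ◇⁼-suc n (inj₁ s) t) ⟩
        ∑ finiteState (λ s′ → step (inj₁ s) s′ * partialSum (λ k → ℙ◇⁼ k s′ t) n)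
          ≤⟨ ∑-mono finiteState (λ s′ → *-monoˡ-≤ (step-nonneg (inj₁ s) s′) (partialSum-ℙ◇⁼≤1 n s′ t)) ⟩
        ∑ finiteState (λ s′ → step (inj₁ s) s′ * 1#)
          ≈⟨ ∑-cong finiteState (λ s′ → *-identityʳ (step (inj₁ s) s′)) ⟩
        ∑ finiteState (prob val s (σ s))
          ≤⟨ ∑prob≤1 s (σ s) ⟩
        1# ∎
      partialSum-ℙ◇⁼≤1 (suc n) (inj₂ t′) t = begin
        ℙ◇⁼ 0 (inj₂ t′) t + partialSum (λ k → ℙ◇⁼ (suc k) (inj₂ t′) t) n
          ≈⟨ +-congˡ (sum-zero {n} λ k → ℙ◇⁼-suc-target val σ (toℕ k) t′ t) ⟩
        ℙ◇⁼ 0 (inj₂ t′) t + 0#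
          ≈⟨ +-identityʳ _ ⟩
        ℙ◇⁼ 0 (inj₂ t′) t
          ≤⟨ ℙ◇⁼-zero≤1 val σ (inj₂ t′) t ⟩
        1# ∎

      ℙ◇-HasSum : ∀ s t → HasSum (λ k → ℙ◇⁼ k s t) (ℙ◇ s t)
      ℙ◇-HasSum s t = HasSum-sup (λ k → ℙ◇⁼ k s t) (λ n → partialSum-ℙ◇⁼≤1 n s t)

-- The lottery probabilities and the scaling factors.

1/-nonNeg : ∀ p .{{_ : ℚ.NonZero p}} .{{_ : ℚ.NonNegative p}} → ℚ.NonNegative (ℚ.1/ p)
1/-nonNeg (ℚ.mkℚ (+ suc _) _ _) = _

module Reduction (ℝ : CompleteOrderedField) (M : WPMDP) (o : TargetOrder M) where
  open CompleteOrderedField ℝ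
  open OrderedField ℝ
  open ≤-Reasoning
  open Series ℝ
  open Polynomials ℝ
  open TargetOrder o

  N : WPMDP
  N = toPMDP M o

  module M = WPMDP M
  module N = WPMDP N
  module 𝓜 = Semantics ℝ M
  module 𝓝 = Semantics ℝ N
  module ReachM = Reachability ℝ M
  module ReachN = Reachability ℝ N
  open M using (Target; State; state; pair; ρ; params; finiteState; finiteTarget; someAction)
  open 𝓜 using (Valuation)

  c : Target → ℚ
  c t′ = ρ t′ ℚ.÷ ρ tₙ

  ρ-nonneg : ∀ t′ → 0ℚ ℚ.≤ ρ t′
  ρ-nonneg t′ = ≡.subst (λ u → 0ℚ ℚ.≤ ρ u) (Inverse.strictlyInverseˡ targets t′)
    (0≤ρt (Inverse.from targets t′))
    where
    0≤ρt : ∀ i → 0ℚ ℚ.≤ ρ (t i)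
    0≤ρt Fin.zero    = ℚ.≤-reflexive (≡.sym lowest)
    0≤ρt (Fin.suc i) = ℚ.<⇒≤ (≡.subst (ℚ._< ρ (t (Fin.suc i))) lowest (increasing (s≤s z≤n)))

  ρ≤ρtₙ : ∀ t′ → ρ t′ ℚ.≤ ρ tₙ
  ρ≤ρtₙ t′ = ≡.subst (λ u → ρ u ℚ.≤ ρ tₙ) (Inverse.strictlyInverseˡ targets t′)
    (ρt≤ρtₙ (Inverse.from targets t′))
    where
    ρt≤ρtₙ : ∀ i → ρ (t i) ℚ.≤ ρ tₙ
    ρt≤ρtₙ i with i Fin.≟ fromℕ n
    ... | yes ≡.refl = ℚ.≤-refl
    ... | no  i≢n    = ℚ.<⇒≤ (increasing (Fin.≤∧≢⇒< (Fin.≤fromℕ i) i≢n))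

  instance
    ρtₙ-nonNeg : ℚ.NonNegative (ρ tₙ)
    ρtₙ-nonNeg = ℚ.nonNegative (ρ-nonneg tₙ)

    1/ρtₙ-nonNeg : ℚ.NonNegative (ℚ.1/ ρ tₙ)
    1/ρtₙ-nonNeg = 1/-nonNeg (ρ tₙ)

  c-nonneg : ∀ t′ → 0ℚ ℚ.≤ c t′
  c-nonneg t′ = ≡.subst (ℚ._≤ c t′) (ℚ.*-zeroˡ (ℚ.1/ ρ tₙ))
    (ℚ.*-monoʳ-≤-nonNeg (ℚ.1/ ρ tₙ) (ρ-nonneg t′))

  1-c-nonneg : ∀ t′ → 0ℚ ℚ.≤ 1ℚ ℚ.- c t′
  1-c-nonneg t′ = ≡.subst (ℚ._≤ 1ℚ ℚ.- c t′) (ℚ.+-inverseʳ (c t′))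
    (ℚ.+-monoˡ-≤ (ℚ.- c t′) (≡.subst (c t′ ℚ.≤_) (ℚ.*-inverseʳ (ρ tₙ))
      (ℚ.*-monoʳ-≤-nonNeg (ℚ.1/ ρ tₙ) (ρ≤ρtₙ t′))))

  -- `κ` is the image of the rational reciprocal rather than the field inverse of `r`, so that it
  -- matches the coefficients `c` by multiplicativity of `fromℚ` alone.
  r κ : Carrier
  r = fromℚ (ρ tₙ)
  κ = fromℚ (ℚ.1/ ρ tₙ)

  r-nonneg : 0# ≤ r
  r-nonneg = fromℚ-nonneg _ (ρ-nonneg tₙ)

  κ-nonneg : 0# ≤ κ
  κ-nonneg = fromℚ-nonneg _ (ℚ.nonNegative⁻¹ (ℚ.1/ ρ tₙ))

  r*κ≈1 : r * κ ≈ 1#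
  r*κ≈1 = begin-equality
    r * κ                      ≈⟨ fromℚ-* (ρ tₙ) (ℚ.1/ ρ tₙ) ⟨
    fromℚ (ρ tₙ ℚ.* ℚ.1/ ρ tₙ) ≡⟨ ≡.cong fromℚ (ℚ.*-inverseʳ (ρ tₙ)) ⟩
    fromℚ 1ℚ                   ≈⟨ fromℚ-1 ⟩
    1#                         ∎

  r*κ*x≈x : ∀ x → r * (κ * x) ≈ x
  r*κ*x≈x x = trans (sym (*-assoc r κ x)) (trans (*-congʳ r*κ≈1) (*-identityˡ x))

  fromℚ-c : ∀ t′ → fromℚ (c t′) ≈ κ * fromℚ (ρ t′)
  fromℚ-c t′ = trans (fromℚ-* (ρ t′) (ℚ.1/ ρ tₙ)) (*-comm _ _)

  fromℚ-c-nonneg : ∀ t′ → 0# ≤ fromℚ (c t′)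
  fromℚ-c-nonneg t′ = fromℚ-nonneg (c t′) (c-nonneg t′)

  fromℚ-complement : ∀ q → fromℚ q + fromℚ (1ℚ ℚ.- q) ≈ 1#
  fromℚ-complement q = begin-equality
    fromℚ q + fromℚ (1ℚ ℚ.- q)  ≈⟨ fromℚ-+ q (1ℚ ℚ.- q) ⟨
    fromℚ (q ℚ.+ (1ℚ ℚ.- q))    ≡⟨ ≡.cong fromℚ (q+[1-q]≡1 q) ⟩
    fromℚ 1ℚ                    ≈⟨ fromℚ-1 ⟩
    1#                          ∎
    where
    q+[1-q]≡1 : ∀ q → q ℚ.+ (1ℚ ℚ.- q) ≡ 1ℚ
    q+[1-q]≡1 q = ≡.trans (≡.cong (q ℚ.+_) (ℚ.+-comm 1ℚ (ℚ.- q)))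
      (≡.trans (≡.sym (ℚ.+-assoc q (ℚ.- q) 1ℚ))
        (≡.trans (≡.cong (ℚ._+ 1ℚ) (ℚ.+-inverseʳ q)) (ℚ.+-identityˡ 1ℚ)))

  -- Transition probabilities of N and graph preservation.

  module _ (val : Valuation) where

    eval-0 : eval ℝ params (const params 0ℚ) val ≈ 0#
    eval-0 = trans (eval-const params 0ℚ val) fromℚ-0

    prob-outcome : ∀ s a u → 𝓝.prob val (inj₁ s) (just a) (inj₂ u) ≈ 0#
    prob-outcome s a u = eval-0

    prob-nothing : ∀ s s′ → 𝓝.prob val (inj₁ s) nothing s′ ≈ 0#
    prob-nothing s s′ = eval-0

    prob-just : ∀ t′ a s′ → 𝓝.prob val (inj₂ t′) (just a) s′ ≈ 0#
    prob-just t′ a s′ = eval-0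

    prob-state : ∀ t′ s′ → 𝓝.prob val (inj₂ t′) nothing (inj₁ s′) ≈ 0#
    prob-state t′ s′ = eval-0

    prob-fin : ∀ t′ → 𝓝.prob val (inj₂ t′) nothing (inj₂ fin) ≈ fromℚ (c t′)
    prob-fin t′ = eval-const params (c t′) val

    prob-fail : ∀ t′ → 𝓝.prob val (inj₂ t′) nothing (inj₂ fail) ≈ fromℚ (1ℚ ℚ.- c t′)
    prob-fail t′ = eval-const params (1ℚ ℚ.- c t′) val

    ∑-inner : ∀ s a → 𝓝.∑ N.finiteState (𝓝.prob val (inj₁ s) (just a)) ≈
              𝓜.∑ finiteState (𝓜.prob val s a)
    ∑-inner s a = begin-equality
      ∑ N.finiteState P                                        ≈⟨ ∑-⊎ finiteState finiteOutcome P ⟩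
      ∑ finiteState (P ∘ inj₁) + ∑ finiteOutcome (P ∘ inj₂)    ≈⟨ +-congˡ (∑-zero finiteOutcome (prob-outcome s a)) ⟩
      ∑ finiteState (P ∘ inj₁) + 0#                            ≈⟨ +-identityʳ _ ⟩
      ∑ finiteState (P ∘ inj₁)                                 ∎
      where P = 𝓝.prob val (inj₁ s) (just a)

    ∑-target : ∀ t′ → 𝓝.∑ N.finiteState (𝓝.prob val (inj₂ t′) nothing) ≈ 1#
    ∑-target t′ = begin-equality
      ∑ N.finiteState P                                        ≈⟨ ∑-⊎ finiteState finiteOutcome P ⟩
      ∑ finiteState (P ∘ inj₁) + ∑ finiteOutcome (P ∘ inj₂)    ≈⟨ +-congʳ (∑-zero finiteState (prob-state t′)) ⟩
      0# + (P (inj₂ fin) + (P (inj₂ fail) + 0#))               ≈⟨ +-identityˡ _ ⟩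
      P (inj₂ fin) + (P (inj₂ fail) + 0#)                      ≈⟨ +-cong (prob-fin t′) (trans (+-identityʳ _) (prob-fail t′)) ⟩
      fromℚ (c t′) + fromℚ (1ℚ ℚ.- c t′)                       ≈⟨ fromℚ-complement (c t′) ⟩
      1#                                                       ∎
      where P = 𝓝.prob val (inj₂ t′) nothing

  IsZero-0 : IsZero params (const params 0ℚ)
  IsZero-0 = IsZero-const params ≡.refl

  enabled-inner : ∀ {s a} → N.Enabled (inj₁ s) (just a) → M.Enabled s a
  enabled-inner (inj₁ s′ , nz) = s′ , nz
  enabled-inner (inj₂ _  , nz) = contradiction IsZero-0 nz

  graphPreserving-N⇒M : ∀ {val} → 𝓝.GraphPreserving val → 𝓜.GraphPreserving val
  graphPreserving-N⇒M {val} gp = record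
    { nonnegative = λ s a s′ → nonnegative (inj₁ s) (just a) (inj₁ s′)
    ; total       = λ s a (s′ , nz) →
        trans (sym (∑-inner val s a)) (total (inj₁ s) (just a) (inj₁ s′ , nz))
    ; nonzero     = λ s a s′ → nonzero (inj₁ s) (just a) (inj₁ s′)
    }
    where open 𝓝.GraphPreserving gp

  -- The pairs that are new in N are either disabled, which makes their total mass irrelevant, or
  -- lotteries with constant probabilities `c` and `1 - c`. If one of these is 0, its edge is absent
  -- from the graph as well.
  graphPreserving-M⇒N : ∀ {val} → 𝓜.GraphPreserving val → 𝓝.GraphPreserving val
  graphPreserving-M⇒N {val} gp = record
    { nonnegative = nonnegative′
    ; total       = total′
    ; nonzero     = nonzero′
    }
    where
    open 𝓜.GraphPreserving gp
    nonnegative′ : ∀ s a s′ → 0# ≤ 𝓝.prob val s a s′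
    nonnegative′ (inj₁ s) (just a) (inj₁ s′)   = nonnegative s a s′
    nonnegative′ (inj₁ s) (just a) (inj₂ u)    = ≤-reflexive (sym (prob-outcome val s a u))
    nonnegative′ (inj₁ s) nothing  s′          = ≤-reflexive (sym (prob-nothing val s s′))
    nonnegative′ (inj₂ t) (just a) s′          = ≤-reflexive (sym (prob-just val t a s′))
    nonnegative′ (inj₂ t) nothing  (inj₁ s′)   = ≤-reflexive (sym (prob-state val t s′))
    nonnegative′ (inj₂ t) nothing  (inj₂ fin)  =
      ≤-respʳ (sym (prob-fin val t)) (fromℚ-nonneg (c t) (c-nonneg t))
    nonnegative′ (inj₂ t) nothing  (inj₂ fail) =
      ≤-respʳ (sym (prob-fail val t)) (fromℚ-nonneg (1ℚ ℚ.- c t) (1-c-nonneg t))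
    total′ : ∀ s a → N.Enabled s a → 𝓝.∑ N.finiteState (𝓝.prob val s a) ≈ 1#
    total′ (inj₁ s) (just a) en       = trans (∑-inner val s a) (total s a (enabled-inner en))
    total′ (inj₁ s) nothing  (_ , nz) = contradiction IsZero-0 nz
    total′ (inj₂ t) (just a) (_ , nz) = contradiction IsZero-0 nz
    total′ (inj₂ t) nothing  _        = ∑-target val t
    nonzero′ : ∀ s a s′ → N.NonZeroδ s a s′ → ¬ (𝓝.prob val s a s′ ≈ 0#)
    nonzero′ (inj₁ s) (just a) (inj₁ s′)   nz = nonzero s a s′ nz
    nonzero′ (inj₁ s) (just a) (inj₂ u)    nz = contradiction IsZero-0 nz
    nonzero′ (inj₁ s) nothing  s′          nz = contradiction IsZero-0 nz
    nonzero′ (inj₂ t) (just a) s′          nz = contradiction IsZero-0 nz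
    nonzero′ (inj₂ t) nothing  (inj₁ s′)   nz = contradiction IsZero-0 nz
    nonzero′ (inj₂ t) nothing  (inj₂ fin)  nz = eval-const-≉0 params nz val
    nonzero′ (inj₂ t) nothing  (inj₂ fail) nz = eval-const-≉0 params nz val

  -- Translation of strategies and comparison of rewards.

  lift : M.Strategy → N.Strategy
  lift σ (inj₁ s) = just (σ s)
  lift σ (inj₂ _) = nothing

  -- The fresh action is disabled at inner states of M; `someAction` is an arbitrary replacement
  -- there.
  drop : N.Strategy → M.Strategy
  drop τ s = fromMaybe (someAction s) (τ (inj₁ s))

  -- The extra step is the lottery. Paths are unfolded at their first step, so the lottery, although
  -- last in the run, appears in the base case of `split`; longer runs reach it by mutual recursion.
  ℙ◇⁼-lift : ∀ val σ k s → 𝓝.Chain.ℙ◇⁼ val (lift σ) (suc k) (inj₁ s) fin ≈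
             ∑ finiteTarget (λ t′ → fromℚ (c t′) * 𝓜.Chain.ℙ◇⁼ val σ k s t′)
  ℙ◇⁼-lift val σ k s = trans (ReachN.ℙ◇⁼-suc val (lift σ) k (inj₁ s) fin)
    (trans (∑-⊎ finiteState finiteOutcome (via k s)) (split k s))
    where
    module CM = 𝓜.Chain val σ
    module CN = 𝓝.Chain val (lift σ)
    via : ℕ → State → N.State → Carrier
    via k s u = CN.step (inj₁ s) u * CN.ℙ◇⁼ k u fin
    payoff : ℕ → State → Carrier
    payoff k s = ∑ finiteTarget (λ t′ → fromℚ (c t′) * CM.ℙ◇⁼ k s t′)
    split : ∀ k s → ∑ finiteState (via k s ∘ inj₁) + ∑ finiteOutcome (via k s ∘ inj₂) ≈ payoff k s
    -- Both sides vanish: one step from an inner state cannot lead to `fin`, and an inner state is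
    -- not itself a target.
    split zero (inj₁ s) = begin-equality
      ∑ finiteState (via 0 (inj₁ s) ∘ inj₁) + ∑ finiteOutcome (via 0 (inj₁ s) ∘ inj₂)
        ≈⟨ +-cong (∑-zero finiteState λ s′ → zeroʳ (CN.step (inj₁ (inj₁ s)) (inj₁ s′)))
                  (∑-zero finiteOutcome λ u → trans (*-congʳ (prob-outcome val s (σ s) u)) (zeroˡ (CN.ℙ◇⁼ 0 (inj₂ u) fin))) ⟩
      0# + 0#
        ≈⟨ +-identityˡ 0# ⟩
      0#
        ≈⟨ ∑-zero finiteTarget (λ t′ → zeroʳ (fromℚ (c t′))) ⟨
      payoff 0 (inj₁ s) ∎
    split zero (inj₂ t′) = begin-equality
      ∑ finiteState (via 0 (inj₂ t′) ∘ inj₁) + (via 0 (inj₂ t′) (inj₂ fin) + (via 0 (inj₂ t′) (inj₂ fail) + 0#))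
        ≈⟨ +-cong (∑-zero finiteState λ s′ → zeroʳ (CN.step (inj₁ (inj₂ t′)) (inj₁ s′)))
                  (+-cong (trans (*-identityʳ _) (prob-fin val t′)) (trans (+-identityʳ _) (zeroʳ _))) ⟩
      0# + (fromℚ (c t′) + 0#)
        ≈⟨ trans (+-identityˡ _) (+-identityʳ _) ⟩
      fromℚ (c t′)
        ≈⟨ hit ⟨
      fromℚ (c t′) * CM.ℙ◇⁼ 0 (inj₂ t′) t′
        ≈⟨ ∑-single finiteTarget (λ u → fromℚ (c u) * CM.ℙ◇⁼ 0 (inj₂ t′) u) t′ miss ⟨
      payoff 0 (inj₂ t′) ∎
      where
      hit : fromℚ (c t′) * CM.ℙ◇⁼ 0 (inj₂ t′) t′ ≈ fromℚ (c t′)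
      hit = trans (*-congˡ (ReachM.ℙ◇⁼-zero-hit val σ t′)) (*-identityʳ _)
      miss : ∀ u → u ≢ t′ → fromℚ (c u) * CM.ℙ◇⁼ 0 (inj₂ t′) u ≈ 0#
      miss u u≢t′ = trans (*-congˡ (ReachM.ℙ◇⁼-zero-miss val σ (u≢t′ ∘ ≡.sym ∘ inj₂-injective))) (zeroʳ _)
    -- The first steps of the two chains agree by computation, so the induction hypothesis applies
    -- to each successor; the rest exchanges the sums over successors and targets.
    split (suc k) (inj₁ s) = begin-equality
      ∑ finiteState (via (suc k) (inj₁ s) ∘ inj₁) + ∑ finiteOutcome (via (suc k) (inj₁ s) ∘ inj₂)
        ≈⟨ +-congˡ (∑-zero finiteOutcome λ u → trans (*-congʳ (prob-outcome val s (σ s) u)) (zeroˡ (CN.ℙ◇⁼ (suc k) (inj₂ u) fin))) ⟩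
      ∑ finiteState (via (suc k) (inj₁ s) ∘ inj₁) + 0#
        ≈⟨ +-identityʳ _ ⟩
      ∑ finiteState (λ s′ → CM.step (inj₁ s) s′ * CN.ℙ◇⁼ (suc k) (inj₁ s′) fin)
        ≈⟨ ∑-cong finiteState (λ s′ → *-congˡ {CM.step (inj₁ s) s′} (ℙ◇⁼-lift val σ k s′)) ⟩
      ∑ finiteState (λ s′ → CM.step (inj₁ s) s′ * payoff k s′)
        ≈⟨ ∑-cong finiteState (λ s′ → ∑-*ˡ finiteTarget (CM.step (inj₁ s) s′) (λ t′ → fromℚ (c t′) * CM.ℙ◇⁼ k s′ t′)) ⟩
      ∑ finiteState (λ s′ → ∑ finiteTarget (λ t′ → CM.step (inj₁ s) s′ * (fromℚ (c t′) * CM.ℙ◇⁼ k s′ t′)))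
        ≈⟨ ∑-swap finiteState finiteTarget (λ s′ t′ → CM.step (inj₁ s) s′ * (fromℚ (c t′) * CM.ℙ◇⁼ k s′ t′)) ⟩
      ∑ finiteTarget (λ t′ → ∑ finiteState (λ s′ → CM.step (inj₁ s) s′ * (fromℚ (c t′) * CM.ℙ◇⁼ k s′ t′)))
        ≈⟨ ∑-cong finiteTarget (λ t′ → begin-equality
             ∑ finiteState (λ s′ → CM.step (inj₁ s) s′ * (fromℚ (c t′) * CM.ℙ◇⁼ k s′ t′))
               ≈⟨ ∑-cong finiteState (λ s′ → x*yz≈y*xz (CM.step (inj₁ s) s′) (fromℚ (c t′)) (CM.ℙ◇⁼ k s′ t′)) ⟩
             ∑ finiteState (λ s′ → fromℚ (c t′) * (CM.step (inj₁ s) s′ * CM.ℙ◇⁼ k s′ t′))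
               ≈⟨ ∑-*ˡ finiteState (fromℚ (c t′)) (λ s′ → CM.step (inj₁ s) s′ * CM.ℙ◇⁼ k s′ t′) ⟨
             fromℚ (c t′) * ∑ finiteState (λ s′ → CM.step (inj₁ s) s′ * CM.ℙ◇⁼ k s′ t′)
               ≈⟨ *-congˡ (ReachM.ℙ◇⁼-suc val σ k (inj₁ s) t′) ⟨
             fromℚ (c t′) * CM.ℙ◇⁼ (suc k) (inj₁ s) t′ ∎) ⟩
      payoff (suc k) (inj₁ s) ∎
    -- Both sides vanish: in N the run has stopped in an outcome after one step, in M it has stopped
    -- in `t′`.
    split (suc k) (inj₂ t′) = begin-equality
      ∑ finiteState (via (suc k) (inj₂ t′) ∘ inj₁) + ∑ finiteOutcome (via (suc k) (inj₂ t′) ∘ inj₂)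
        ≈⟨ +-cong (∑-zero finiteState λ s′ → trans (*-congʳ (prob-state val t′ s′)) (zeroˡ (CN.ℙ◇⁼ (suc k) (inj₁ s′) fin)))
                  (∑-zero finiteOutcome λ u → trans (*-congˡ (ReachN.ℙ◇⁼-suc-target val (lift σ) k u fin)) (zeroʳ (CN.step (inj₁ (inj₂ t′)) (inj₂ u)))) ⟩
      0# + 0#
        ≈⟨ +-identityˡ 0# ⟩
      0#
        ≈⟨ ∑-zero finiteTarget (λ u → trans (*-congˡ (ReachM.ℙ◇⁼-suc-target val σ k t′ u)) (zeroʳ (fromℚ (c u)))) ⟨
      payoff (suc k) (inj₂ t′) ∎

  Rew-N-state : ∀ val τ s → 𝓝.Rew val τ (N.state s) ≈ 𝓝.Chain.ℙ◇ val τ s fin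
  Rew-N-state val τ s = begin-equality
    fromℚ 1ℚ * ℙ fin + (fromℚ 0ℚ * ℙ fail + 0#)
      ≈⟨ +-cong (*-congʳ fromℚ-1) (trans (+-identityʳ _) (*-congʳ fromℚ-0)) ⟩
    1# * ℙ fin + 0# * ℙ fail
      ≈⟨ +-cong (*-identityˡ _) (zeroˡ _) ⟩
    ℙ fin + 0#
      ≈⟨ +-identityʳ _ ⟩
    ℙ fin ∎
    where ℙ = 𝓝.Chain.ℙ◇ val τ s

  module _ {val : Valuation} (gp : 𝓜.GraphPreserving val) where

    gpN : 𝓝.GraphPreserving val
    gpN = graphPreserving-M⇒N gp

    Rew-lift-state : ∀ σ s → 𝓝.Rew val (lift σ) (N.state (inj₁ s)) ≈ κ * 𝓜.Rew val σ (state s)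
    Rew-lift-state σ s = begin-equality
      𝓝.Rew val (lift σ) (N.state (inj₁ s))
        ≈⟨ Rew-N-state val (lift σ) (inj₁ s) ⟩
      𝓝.Chain.ℙ◇ val (lift σ) (inj₁ s) fin
        ≈⟨ HasSum-unique (ReachN.ℙ◇-HasSum gpN (lift σ) (inj₁ s) fin)
             -- The zero-step term of N is 0 by computation, since a state of M is not `fin`.
             (HasSum-suc refl (HasSum-cong (λ k → sym (ℙ◇⁼-lift val σ k s)) payoff-HasSum)) ⟩
      ∑ finiteTarget (λ t′ → fromℚ (c t′) * ℙ t′)
        ≈⟨ ∑-cong finiteTarget (λ t′ → trans (*-congʳ {ℙ t′} (fromℚ-c t′)) (*-assoc κ (fromℚ (ρ t′)) (ℙ t′))) ⟩
      ∑ finiteTarget (λ t′ → κ * (fromℚ (ρ t′) * ℙ t′))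
        ≈⟨ ∑-*ˡ finiteTarget κ (λ t′ → fromℚ (ρ t′) * ℙ t′) ⟨
      κ * 𝓜.Rew val σ (state s) ∎
      where
      ℙ = 𝓜.Chain.ℙ◇ val σ s
      payoff-HasSum : HasSum (λ k → ∑ finiteTarget (λ t′ → fromℚ (c t′) * 𝓜.Chain.ℙ◇⁼ val σ k s t′))
                             (∑ finiteTarget (λ t′ → fromℚ (c t′) * ℙ t′))
      payoff-HasSum = HasSum-∑ finiteTarget
        (λ t′ k → *-nonneg (fromℚ-c-nonneg t′) (ReachM.ℙ◇⁼-nonneg gp σ k s t′))
        (λ t′ → HasSum-* (fromℚ-c-nonneg t′) (ReachM.ℙ◇-HasSum gp σ s t′))

    -- The guards `move?` of the two models agree by computation on states of M, because they test
    -- the same polynomial; only the summands for outcomes have to be discarded.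
    Rew-N-pair : ∀ τ s a → 𝓝.Rew val τ (N.pair (inj₁ s) (just a)) ≈
      ∑ finiteState (λ s′ → if does (M.move? s a s′)
        then 𝓜.prob val s a s′ * 𝓝.Rew val τ (N.state (inj₁ s′)) else 0#)
    Rew-N-pair τ s a = begin-equality
      ∑ N.finiteState f                                     ≈⟨ ∑-⊎ finiteState finiteOutcome f ⟩
      ∑ finiteState (f ∘ inj₁) + ∑ finiteOutcome (f ∘ inj₂) ≈⟨ +-congˡ (∑-zero finiteOutcome outcome) ⟩
      ∑ finiteState (f ∘ inj₁) + 0#                         ≈⟨ +-identityʳ _ ⟩
      ∑ finiteState (f ∘ inj₁)                              ∎
      where
      f : N.State → Carrier
      f s′ = if does (N.move? (inj₁ s) (just a) s′)
        then 𝓝.prob val (inj₁ s) (just a) s′ * 𝓝.Rew val τ (N.state s′) else 0#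
      outcome : ∀ u → f (inj₂ u) ≈ 0#
      outcome u with does (N.move? (inj₁ s) (just a) (inj₂ u))
      ... | true  = trans (*-congʳ (prob-outcome val s a u)) (zeroˡ _)
      ... | false = refl

    Rew-lift : ∀ σ v → 𝓝.Rew val (lift σ) (embed M o v) ≈ κ * 𝓜.Rew val σ v
    Rew-lift σ (state s)  = Rew-lift-state σ s
    Rew-lift σ (pair s a) = begin-equality
      𝓝.Rew val (lift σ) (N.pair (inj₁ s) (just a))
        ≈⟨ Rew-N-pair (lift σ) s a ⟩
      ∑ finiteState (λ s′ → if does (M.move? s a s′)
        then 𝓜.prob val s a s′ * 𝓝.Rew val (lift σ) (N.state (inj₁ s′)) else 0#)
        ≈⟨ ∑-cong finiteState scale ⟩
      ∑ finiteState (λ s′ → κ * f s′)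
        ≈⟨ ∑-*ˡ finiteState κ f ⟨
      κ * 𝓜.Rew val σ (pair s a) ∎
      where
      f : State → Carrier
      f s′ = if does (M.move? s a s′) then 𝓜.prob val s a s′ * 𝓜.Rew val σ (state s′) else 0#
      scale : ∀ s′ → (if does (M.move? s a s′)
        then 𝓜.prob val s a s′ * 𝓝.Rew val (lift σ) (N.state (inj₁ s′)) else 0#) ≈ κ * f s′
      scale s′ with does (M.move? s a s′)
      ... | true  = trans (*-congˡ (Rew-lift-state σ s′)) (x*yz≈y*xz _ κ _)
      ... | false = sym (zeroʳ κ)

    -- Choosing a disabled action stops the run, so replacing all such choices
    -- does not decrease any transition probability.
    step≤step-lift-drop : ∀ τ s s′ →
      𝓝.Chain.step val τ s s′ ≤ 𝓝.Chain.step val (lift (drop τ)) s s′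
    step≤step-lift-drop τ (inj₁ (inj₁ s)) s′ with τ (inj₁ s)
    ... | just a  = ≤-refl
    ... | nothing = ≤-respˡ (sym (prob-nothing val s s′))
      (𝓝.GraphPreserving.nonnegative gpN (inj₁ s) (just (someAction s)) s′)
    step≤step-lift-drop τ (inj₁ (inj₂ t′)) s′ with τ (inj₂ t′)
    ... | just a  = ≤-respˡ (sym (prob-just val t′ a s′))
      (𝓝.GraphPreserving.nonnegative gpN (inj₂ t′) nothing s′)
    ... | nothing = ≤-refl
    step≤step-lift-drop τ (inj₂ _) s′ = ≤-refl

    ℙ◇⁼≤ℙ◇⁼-lift-drop : ∀ τ k s u →
      𝓝.Chain.ℙ◇⁼ val τ k s u ≤ 𝓝.Chain.ℙ◇⁼ val (lift (drop τ)) k s u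
    ℙ◇⁼≤ℙ◇⁼-lift-drop τ zero    s u = ≤-refl
    ℙ◇⁼≤ℙ◇⁼-lift-drop τ (suc k) s u = begin
      𝓝.Chain.ℙ◇⁼ val τ (suc k) s u
        ≈⟨ ReachN.ℙ◇⁼-suc val τ k s u ⟩
      ∑ N.finiteState (λ s′ → 𝓝.Chain.step val τ s s′ * 𝓝.Chain.ℙ◇⁼ val τ k s′ u)
        ≤⟨ ∑-mono N.finiteState (λ s′ → ≤-trans
             -- The two factors are raised one at a time, each against the nonnegative other one.
             (*-monoʳ-≤ (ReachN.ℙ◇⁼-nonneg gpN τ k s′ u) (step≤step-lift-drop τ s s′))
             (*-monoˡ-≤ (ReachN.step-nonneg gpN τ′ s s′) (ℙ◇⁼≤ℙ◇⁼-lift-drop τ k s′ u))) ⟩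
      ∑ N.finiteState (λ s′ → 𝓝.Chain.step val τ′ s s′ * 𝓝.Chain.ℙ◇⁼ val τ′ k s′ u)
        ≈⟨ ReachN.ℙ◇⁼-suc val τ′ k s u ⟨
      𝓝.Chain.ℙ◇⁼ val τ′ (suc k) s u ∎
      where τ′ = lift (drop τ)

    Rew-N-state≤ : ∀ τ s → 𝓝.Rew val τ (N.state s) ≤ 𝓝.Rew val (lift (drop τ)) (N.state s)
    Rew-N-state≤ τ s = begin
      𝓝.Rew val τ (N.state s)
        ≈⟨ Rew-N-state val τ s ⟩
      𝓝.Chain.ℙ◇ val τ s fin
        ≤⟨ HasSum-mono (λ k → ℙ◇⁼≤ℙ◇⁼-lift-drop τ k s fin)
             (ReachN.ℙ◇-HasSum gpN τ s fin) (ReachN.ℙ◇-HasSum gpN (lift (drop τ)) s fin) ⟩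
      𝓝.Chain.ℙ◇ val (lift (drop τ)) s fin
        ≈⟨ Rew-N-state val (lift (drop τ)) s ⟨
      𝓝.Rew val (lift (drop τ)) (N.state s) ∎

    Rew≤Rew-lift-drop : ∀ τ v → 𝓝.Rew val τ (embed M o v) ≤ κ * 𝓜.Rew val (drop τ) v
    Rew≤Rew-lift-drop τ v = ≤-respʳ (Rew-lift (drop τ) v) (embed≤ v)
      where
      embed≤ : ∀ v → 𝓝.Rew val τ (embed M o v) ≤ 𝓝.Rew val (lift (drop τ)) (embed M o v)
      embed≤ (state s)  = Rew-N-state≤ τ (inj₁ s)
      -- A pair fixes its own action, so repairing `τ` affects only the values of its successors.
      embed≤ (pair s a) = ∑-mono N.finiteState successor≤
        where
        successor≤ : ∀ s′ →
          (if does (N.move? (inj₁ s) (just a) s′)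
            then 𝓝.prob val (inj₁ s) (just a) s′ * 𝓝.Rew val τ (N.state s′) else 0#) ≤
          (if does (N.move? (inj₁ s) (just a) s′)
            then 𝓝.prob val (inj₁ s) (just a) s′ * 𝓝.Rew val (lift (drop τ)) (N.state s′) else 0#)
        successor≤ s′ with does (N.move? (inj₁ s) (just a) s′)
        ... | true  = *-monoˡ-≤ (𝓝.GraphPreserving.nonnegative gpN (inj₁ s) (just a) s′) (Rew-N-state≤ τ s′)
        ... | false = ≤-refl

    Rew*-M⇒N : ∀ v {x} → 𝓜.Rew* val v x → 𝓝.Rew* val (embed M o v) (κ * x)
    Rew*-M⇒N v ((σ , Rew≈x) , Rew≤x) =
      (lift σ , trans (Rew-lift σ v) (*-congˡ Rew≈x)) ,
      (λ τ → ≤-trans (Rew≤Rew-lift-drop τ v) (*-monoˡ-≤ κ-nonneg (Rew≤x (drop τ))))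

    Rew≈r*Rew-lift : ∀ σ v → 𝓜.Rew val σ v ≈ r * 𝓝.Rew val (lift σ) (embed M o v)
    Rew≈r*Rew-lift σ v = trans (sym (r*κ*x≈x _)) (*-congˡ (sym (Rew-lift σ v)))

    -- The maximising `τ` need not be a lift. Dropping it loses no reward, while lifting any
    -- strategy of M bounds its reward by `r * x`; the two inequalities pin down the reward of
    -- `drop τ`.
    Rew*-N⇒M : ∀ v {x} → 𝓝.Rew* val (embed M o v) x → 𝓜.Rew* val v (r * x)
    Rew*-N⇒M v {x} ((τ , Rew≈x) , Rew≤x) = (drop τ , antisym (Rew≤r*x (drop τ)) (begin
      r * x                           ≈⟨ *-congˡ Rew≈x ⟨
      r * 𝓝.Rew val τ (embed M o v)   ≤⟨ *-monoˡ-≤ r-nonneg (Rew≤Rew-lift-drop τ v) ⟩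
      r * (κ * 𝓜.Rew val (drop τ) v)  ≈⟨ r*κ*x≈x _ ⟩
      𝓜.Rew val (drop τ) v            ∎)) , Rew≤r*x
      where
      Rew≤r*x : ∀ σ → 𝓜.Rew val σ v ≤ r * x
      Rew≤r*x σ = ≤-respˡ (sym (Rew≈r*Rew-lift σ v)) (*-monoˡ-≤ r-nonneg (Rew≤x (lift σ)))

  -- Transfer of the never-worse relation.

  module _ (v : M.Vertex) (W : Pred M.Vertex 0ℓ) where

    ⊴-M⇒N : v 𝓜.⊴ W → embed M o v 𝓝.⊴ image M o W
    ⊴-M⇒N v⊴W val gpN with gp ← graphPreserving-N⇒M gpN with v⊴W val gp
    ... | w , w∈W , x , y , v*x , w*y , x≤y =
      embed M o w , (w , w∈W , ≡.refl) , κ * x , κ * y ,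
      Rew*-M⇒N gp v v*x , Rew*-M⇒N gp w w*y , *-monoˡ-≤ κ-nonneg x≤y

    ⊴-N⇒M : embed M o v 𝓝.⊴ image M o W → v 𝓜.⊴ W
    ⊴-N⇒M v⊴W val gp with v⊴W val (graphPreserving-M⇒N gp)
    ... | _ , (w , w∈W , ≡.refl) , x , y , v*x , w*y , x≤y =
      w , w∈W , r * x , r * y ,
      Rew*-N⇒M gp v v*x , Rew*-N⇒M gp w w*y , *-monoˡ-≤ r-nonneg x≤y

theorem1 : (ℝ : CompleteOrderedField) (M : WPMDP) (o : TargetOrder M) →
    let module 𝓜 = Semantics ℝ M
        module 𝓝 = Semantics ℝ (toPMDP M o)
    in (v : WPMDP.Vertex M) (W : Pred (WPMDP.Vertex M) 0ℓ) →
       (v 𝓜.⊴ W) ⇔ (embed M o v 𝓝.⊴ image M o W)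
theorem1 ℝ M o v W = mk⇔ (⊴-M⇒N v W) (⊴-N⇒M v W)
  where open Reduction ℝ M o
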